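{- Let $m \geq 5$ be an integer. Then the propagation time of the helm graph $H_m$ is $$\mathrm{pt}(H_m) = \begin{cases} 6 & \text{if } m \equiv 0 \pmod 4,\\ 4 & \text{if } m \equiv 1 \pmod 4,\\ 5 & \text{if } m \equiv 2 \pmod 4,\\ 5 & \text{if } m \equiv 3 \pmod 4. \end{cases}$$
   Context: The helm graph $H_m$ is the (simple, undirected) graph with vertex set $\{v_0,v_1,\dots,v_m\} \cup \{p_1,\dots,p_m\}$ whose edges are: $v_0v_i$ for $1\le i\le m$; $v_iv_{i+1}$ for $1 \le i \le m-1$; $v_1v_m$; and $v_ip_i$ for $1\le i\le m$. That is, it is the wheel with center $v_0$ and $m$ spoke vertices, with one pendant vertex attached to each spoke vertex. Zero forcing: each vertex of a graph $G$ is initially colored blue or white. Color change rule: if $u$ is blue and $v$ is the only white neighbor of $u$, then $u$ can force $v$ to become blue; blue vertices stay blue. A set $B \subseteq V(G)$ is a zero forcing set of $G$ if, starting with exactly the vertices of $B$ blue, repeated application of the rule eventually makes every vertex blue. The zero forcing number $\mathrm{Z}(G)$ is the minimum cardinality of a zero forcing set of $G$. Propagation time: for a zero forcing set $B$ let $B^{[0]} = B$ and, for $k \geq 1$, let $B^{[k]} = B^{[k-1]} \cup B^{(k)}$, where $B^{(k)}$ is the set of all white vertices that can be forced by the color change rule when $B^{[k-1]}$ is exactly the set of blue vertices (all possible forces are performed simultaneously in each time-step). Then $\mathrm{pt}(G,B)$ is the least $k$ with $B^{[k]} = V(G)$, and $\mathrm{pt}(G) = \min\{\mathrm{pt}(G,B)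 : B \text{ is a zero forcing set of } G \text{ with } |B| = \mathrm{Z}(G)\}$. -}

module Defs where

open import Data.Fin using (Fin; zero; suc; toℕ; splitAt; _↑ˡ_; _↑ʳ_)
open import Data.Fin.Properties using (splitAt-↑ˡ; splitAt-↑ʳ; splitAt⁻¹-↑ˡ; splitAt⁻¹-↑ʳ; any?; all?)
  renaming (_≟_ to _≟ᶠ_)
open import Data.Fin.Subset using (Subset; ⊤; ⁅_⁆; _∈_; _∉_; _∪_; ∣_∣)
open import Data.Fin.Subset.Properties using (_∈?_)
open import Data.Nat using (ℕ; zero; suc; _+_; _≤_; s≤s; _≟_)
open import Data.Nat.Properties using (1+n≢n)
open import Data.Product using (∃; _×_; _,_)
open import Data.Sum using (inj₁; inj₂)
open import Data.Vec using (tabulate)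
open import Function using (_∘_; _on_)
open import Function.Bundles using (_↔_; mk↔ₛ′; module Inverse)
open import Level using (0ℓ)
open import Relation.Binary using (Rel; Symmetric; Irreflexive) renaming (Decidable to Decidable₂)
open import Relation.Binary.Construct.Closure.ReflexiveTransitive using (Star)
open import Relation.Binary.Construct.Closure.Symmetric using (SymClosure; fwd; bwd; symmetric)
open import Relation.Binary.PropositionalEquality using (_≡_; refl; sym; trans; cong)
open import Relation.Nullary using (¬_; Dec; yes; no; does; map′; ¬?; _×-dec_; _⊎-dec_; _→-dec_)

IsLeast : (ℕ → Set) → ℕ → Set
IsLeast P k = P k × (∀ j → P j → k ≤ j)

-- Finite simple undirected graphs.  Adjacency is decidable, so that the set
-- of vertices forced in one time-step is again a `Subset`.

record Graph : Set₁ where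
  field
    order      : ℕ
    Adj        : Rel (Fin order) 0ℓ
    adj-sym    : Symmetric Adj
    adj-irrefl : Irreflexive _≡_ Adj
    adj?       : Decidable₂ Adj

module ZeroForcing (G : Graph) where
  open Graph G

  Vertex : Set
  Vertex = Fin order

  -- Throughout, a subset is the set of blue vertices; the others are white.

  Forces : Subset order → Vertex → Vertex → Set
  Forces S u v =
    u ∈ S × v ∉ S × Adj u v × (∀ w → Adj u w → w ∉ S → w ≡ v)

  forces? : ∀ S u v → Dec (Forces S u v)
  forces? S u v =
    (u ∈? S) ×-dec ¬? (v ∈? S) ×-dec adj? u v ×-dec
    all? (λ w → adj? u w →-dec (¬? (w ∈? S) →-dec (w ≟ᶠ v)))

  -- A single application of the colour change rule.
  data _⟶_ (S : Subset order) : Subset order → Set where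
    force : ∀ {u v} → Forces S u v → S ⟶ (S ∪ ⁅ v ⁆)

  IsZeroForcingSet : Subset order → Set
  IsZeroForcingSet B = Star _⟶_ B ⊤

  IsZeroForcingNumber : ℕ → Set
  IsZeroForcingNumber = IsLeast (λ z → ∃ λ B → IsZeroForcingSet B × ∣ B ∣ ≡ z)

  -- All vertices that can be forced when exactly S is blue: the B^(k+1)
  -- obtained from S = B^[k].
  forced : Subset order → Subset order
  forced S = tabulate (λ v → does (any? (λ u → forces? S u v)))

  -- B^[k]
  blueAfter : Subset order → ℕ → Subset order
  blueAfter B zero    = B
  blueAfter B (suc k) = blueAfter B k ∪ forced (blueAfter B k)

  -- pt(G, B) = k
  IsPropagationTimeOf : Subset order → ℕ → Set
  IsPropagationTimeOf B = IsLeast (λ k → blueAfter B k ≡ ⊤)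

open ZeroForcing public
  using (IsZeroForcingSet; IsZeroForcingNumber; IsPropagationTimeOf)

-- pt(G) = t.  The minimum is a relation rather than a function: it asserts
-- that the minimum exists and equals t.

IsPropagationTime : Graph → ℕ → Set
IsPropagationTime G = IsLeast λ t → ∃ λ B →
  IsZeroForcingSet G B × IsZeroForcingNumber G ∣ B ∣ × IsPropagationTimeOf G B t

-- The indices 1, …, m of the vertices vᵢ and pᵢ are shifted to
-- 0, …, m - 1, the elements of Fin m.

data HelmVertex (m : ℕ) : Set where
  v₀ : HelmVertex m
  v  : Fin m → HelmVertex m
  p  : Fin m → HelmVertex m

data HelmEdge (m : ℕ) : Rel (HelmVertex m) 0ℓ where
  spoke   : ∀ i → HelmEdge m v₀ (v i)
  rim     : ∀ {i j} → toℕ j ≡ suc (toℕ i) → HelmEdge m (v i) (v j)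
  closing : ∀ {i j} → toℕ i ≡ 0 → suc (toℕ j) ≡ m → HelmEdge m (v i) (v j)
  pendant : ∀ i → HelmEdge m (v i) (p i)

helmVertices : ∀ m → Fin (suc (m + m)) ↔ HelmVertex m
helmVertices m = mk↔ₛ′ to from to∘from from∘to
  where
  to : Fin (suc (m + m)) → HelmVertex m
  to zero = v₀
  to (suc x) with splitAt m x
  ... | inj₁ i = v i
  ... | inj₂ i = p i

  from : HelmVertex m → Fin (suc (m + m))
  from v₀    = zero
  from (v i) = suc (i ↑ˡ m)
  from (p i) = suc (m ↑ʳ i)

  to∘from : ∀ a → to (from a) ≡ a
  to∘from v₀    = refl
  to∘from (v i) rewrite splitAt-↑ˡ m i m = refl
  to∘from (p i) rewrite splitAt-↑ʳ m m i = refl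

  from∘to : ∀ x → from (to x) ≡ x
  from∘to zero = refl
  from∘to (suc x) with splitAt m x in eq
  ... | inj₁ i = cong suc (splitAt⁻¹-↑ˡ eq)
  ... | inj₂ i = cong suc (splitAt⁻¹-↑ʳ eq)

helmEdge? : ∀ m → Decidable₂ (HelmEdge m)
helmEdge? m v₀ v₀       = no λ ()
helmEdge? m v₀ (v i)    = yes (spoke i)
helmEdge? m v₀ (p i)    = no λ ()
helmEdge? m (v i) v₀    = no λ ()
helmEdge? m (v i) (v j) =
  map′ (λ { (inj₁ eq) → rim eq ; (inj₂ (i≡0 , j≡m)) → closing i≡0 j≡m })
       (λ { (rim eq) → inj₁ eq ; (closing i≡0 j≡m) → inj₂ (i≡0 , j≡m) })
       ((toℕ j ≟ suc (toℕ i)) ⊎-dec ((toℕ i ≟ 0) ×-dec (suc (toℕ j) ≟ m)))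
helmEdge? m (v i) (p j) =
  map′ (λ { refl → pendant i }) (λ { (pendant _) → refl }) (i ≟ᶠ j)
helmEdge? m (p i) b     = no λ ()

helmEdge-irrefl : ∀ {m} → 3 ≤ m → ∀ {a} → ¬ HelmEdge m a a
helmEdge-irrefl 3≤m (rim eq) = 1+n≢n (sym eq)
helmEdge-irrefl 3≤m (closing i≡0 j≡m)
  with refl ← trans (cong suc (sym i≡0)) j≡m
  with s≤s () ← 3≤m

-- H_m; for m = 1 the edge v₁vₘ would be a loop, hence a lower bound on m.

helm : (m : ℕ) → 3 ≤ m → Graph
helm m 3≤m = record
  { order      = suc (m + m)
  ; Adj        = Adj
  ; adj-sym    = symmetric (HelmEdge m)
  ; adj-irrefl = λ { refl (fwd e) → helmEdge-irrefl 3≤m e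
                   ; refl (bwd e) → helmEdge-irrefl 3≤m e }
  ; adj?       = λ x y → map′ (λ { (inj₁ e) → fwd e ; (inj₂ e) → bwd e })
                              (λ { (fwd e) → inj₁ e ; (bwd e) → inj₂ e })
                              (helmEdge? m (decode x) (decode y)
                               ⊎-dec helmEdge? m (decode y) (decode x))
  }
  where
  decode : Fin (suc (m + m)) → HelmVertex m
  decode = Inverse.to (helmVertices m)

  Adj : Rel (Fin (suc (m + m))) 0ℓ
  Adj = SymClosure (HelmEdge m) on decode

-- Record the time-step in which each vertex turns blue and a vertex forcing it. A vertex forces
-- at most once, so at most ∣B∣ vertices never force; as a pendant that is initially white never
-- forces, m ≤ 2 ∣B∣, with at most one exception ("defect") to the rules "only pendants are
-- initially blue" and "every spoke, the hub and every initially blue pendant force" when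
-- 2 ∣B∣ ≤ m + 1. If v₀ is initially white, a spoke with white pendant waits for v₀, which is blue
-- at time 2 at the earliest, and for v₀ to force in turn, all other spokes have to be blue; this
-- gives the lower bounds up to one time-step. When the bound is attained, every spoke with blue pendant
-- has exactly one rim neighbour with blue pendant, except that the spoke forcing v₀ has two.
-- By the handshake lemma on the rim, the number of blue pendants is then even if v₀ is initially
-- blue and odd otherwise, which makes ∣B∣ odd and decides between the residue classes mod 4.

module Submission where

open import Defs
open import Data.Nat using (ℕ; zero; suc; pred; _+_; _*_; _≤_; _<_; _%_; z≤n; s≤s; _≟_; _<?_)
open import Data.Nat.Properties
open import Data.Nat.DivMod using (_/_; m≡m%n+[m/n]*n)
open import Data.Nat.Divisibility using (_∣_; m∣m*n; n∣m*n; ∣m+n∣m⇒∣n; ∣m∣n⇒∣m+n; ∣-refl; ∣1⇒≡1)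
open import Data.Nat.Tactic.RingSolver using (solve-∀)
open import Data.Bool using (true; if_then_else_)
open import Data.Fin using (Fin; zero; suc; toℕ; _↑ˡ_; _↑ʳ_; fromℕ; fromℕ<; inject₁)
open import Data.Fin.Permutation using (Permutation′; permutation)
open import Data.Fin.Properties using (any?; toℕ-injective; toℕ-fromℕ; toℕ-fromℕ<; toℕ-inject₁; toℕ<n)
  renaming (_≟_ to _≟ᶠ_; suc-injective to sucᶠ-injective)
open import Data.Fin.Relation.Unary.Top using (view; ‵fromℕ; ‵inj₁; ‵inject₁; view-fromℕ; view-inject₁)
open import Data.Fin.Subset using (Subset; inside; outside; ⊤; ⁅_⁆; _∈_; _∉_; _⊆_; _∪_; ∣_∣)
open import Data.Fin.Subset.Properties
  using (_∈?_; ⊆-antisym; ∈⊤; p⊆p∪q; q⊆p∪q; x∈p∪q⁻; x∈⁅x⁆; x∈⁅y⁆⇒x≡y; drop-there)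
open import Data.List using (List; []; _∷_; _++_; length; allFin)
import Data.List.Membership.Propositional as List
open import Data.List.Membership.Propositional.Properties using (∈-allFin)
open import Data.List.Relation.Unary.All using (All; []; _∷_; all?)
import Data.List.Relation.Unary.Any as Any
open import Data.Product using (∃-syntax; _×_; _,_; proj₁; proj₂)
open import Data.Sum using (_⊎_; inj₁; inj₂; [_,_]′)
open import Data.Vec using (tabulate; []; _∷_; here; there)
open import Data.Vec.Properties using (lookup∘tabulate; []=⇒lookup; lookup⇒[]=)
open import Function using (_∘_; _on_)
open import Function.Bundles using (_↔_; Inverse)
open import Relation.Binary using (Symmetric)
open import Relation.Binary.Construct.Closure.ReflexiveTransitive using (Star; ε; _◅_; _◅◅_)
open import Relation.Binary.Construct.Closure.Symmetric using (SymClosure; fwd; bwd; symmetric)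
open import Relation.Binary.PropositionalEquality
open import Relation.Nullary using (¬_; Dec; yes; no; does; ¬?; contradiction; map′; _×-dec_)
open import Relation.Nullary.Decidable using (True; toWitness; decidable-stable; dec-true)
open import Relation.Unary using (Decidable)

open import Algebra.Properties.CommutativeMonoid.Sum +-0-commutativeMonoid
  using (sum; sum-cong-≗; ∑-distrib-+; ∑-comm; sum-permute)

-- Finite sums and indicators

ind : ∀ {P : Set} → Dec P → ℕ
ind d = if does d then 1 else 0

ind-yes : ∀ {P : Set} (d : Dec P) → P → ind d ≡ 1
ind-yes (yes _) _ = refl
ind-yes (no ¬x) x = contradiction x ¬x

ind-no : ∀ {P : Set} (d : Dec P) → ¬ P → ind d ≡ 0
ind-no (yes x) ¬x = contradiction x ¬x
ind-no (no _)  _  = refl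

from-does : ∀ {P : Set} (d : Dec P) → does d ≡ true → P
from-does (yes x) _ = x

ind≡0⇒¬ : ∀ {P : Set} (d : Dec P) → ind d ≡ 0 → ¬ P
ind≡0⇒¬ (no ¬x) _ = ¬x

ind-¬ : ∀ {P : Set} (d : Dec P) → ind (¬? d) + ind d ≡ 1
ind-¬ (yes _) = refl
ind-¬ (no _)  = refl

ind-¬≡0⇒ : ∀ {P : Set} (d : Dec P) → ind (¬? d) ≡ 0 → P
ind-¬≡0⇒ (yes x) _ = x

ind≤ : ∀ {P : Set} {n} (d : Dec P) → (P → 1 ≤ n) → ind d ≤ n
ind≤ (yes x) 1≤n = 1≤n x
ind≤ (no _)  _   = z≤n

∈-tabulate⁺ : ∀ {n} {P : Fin n → Set} (P? : Decidable P) {x} → P x → x ∈ tabulate (does ∘ P?)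
∈-tabulate⁺ P? {x} px = lookup⇒[]= x _ (trans (lookup∘tabulate (does ∘ P?) x) (dec-true (P? x) px))

∈-tabulate⁻ : ∀ {n} {P : Fin n → Set} (P? : Decidable P) {x} → x ∈ tabulate (does ∘ P?) → P x
∈-tabulate⁻ P? {x} x∈ = from-does (P? x) (trans (sym (lookup∘tabulate (does ∘ P?) x)) ([]=⇒lookup x∈))

∣∣≡sum : ∀ {n} {P : Fin n → Set} (S : Subset n) (P? : Decidable P) →
         (∀ {x} → x ∈ S → P x) → (∀ {x} → P x → x ∈ S) → ∣ S ∣ ≡ sum (ind ∘ P?)
∣∣≡sum []            P? to from = refl
∣∣≡sum (inside ∷ S)  P? to from =
  cong₂ _+_ (sym (ind-yes (P? zero) (to here))) (∣∣≡sum S (P? ∘ suc) (to ∘ there) (drop-there ∘ from))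
∣∣≡sum (outside ∷ S) P? to from =
  cong₂ _+_ (sym (ind-no (P? zero) (λ px → case-here (from px)))) (∣∣≡sum S (P? ∘ suc) (to ∘ there) (drop-there ∘ from))
  where
  case-here : ¬ (zero ∈ outside ∷ S)
  case-here ()

sum-mono : ∀ {n} {f g : Fin n → ℕ} → (∀ i → f i ≤ g i) → sum f ≤ sum g
sum-mono {zero}  f≤g = z≤n
sum-mono {suc n} f≤g = +-mono-≤ (f≤g zero) (sum-mono (f≤g ∘ suc))

term≤sum : ∀ {n} (f : Fin n → ℕ) i → f i ≤ sum f
term≤sum f zero    = m≤m+n _ _
term≤sum f (suc i) = ≤-trans (term≤sum (f ∘ suc) i) (m≤n+m _ _)

two-terms≤sum : ∀ {n} (f : Fin n → ℕ) {i j} → i ≢ j → f i + f j ≤ sum f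
two-terms≤sum f {zero}  {zero}  i≢j = contradiction refl i≢j
two-terms≤sum f {zero}  {suc j} i≢j = +-monoʳ-≤ (f zero) (term≤sum (f ∘ suc) j)
two-terms≤sum f {suc i} {zero}  i≢j =
  ≤-trans (≤-reflexive (+-comm (f (suc i)) (f zero))) (+-monoʳ-≤ (f zero) (term≤sum (f ∘ suc) i))
two-terms≤sum f {suc i} {suc j} i≢j =
  ≤-trans (two-terms≤sum (f ∘ suc) (i≢j ∘ cong suc)) (m≤n+m _ _)

sum-zero : ∀ {n} {f : Fin n → ℕ} → (∀ i → f i ≡ 0) → sum f ≡ 0
sum-zero {zero}  f≡0 = refl
sum-zero {suc n} f≡0 = cong₂ _+_ (f≡0 zero) (sum-zero (f≡0 ∘ suc))

sum-one : ∀ n → sum {n} (λ _ → 1) ≡ n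
sum-one zero    = refl
sum-one (suc n) = cong suc (sum-one n)

sum<⇒zero-term : ∀ {n} (f : Fin n → ℕ) → sum f < n → ∃[ i ] f i ≡ 0
sum<⇒zero-term {n} f sum<n with any? (λ i → f i ≟ 0)
... | yes found = found
... | no  none  = contradiction
  (≤-trans (≤-reflexive (sym (sum-one n))) (sum-mono (λ i → n≢0⇒n>0 (λ z → none (i , z)))))
  (<⇒≱ sum<n)

sum-ind-unique : ∀ {n} {P : Fin n → Set} (P? : Decidable P) →
                 (∀ {x y} → P x → P y → x ≡ y) → sum (ind ∘ P?) ≤ 1
sum-ind-unique {zero}  P? unique = z≤n
sum-ind-unique {suc n} P? unique with P? zero
... | yes p₀ = ≤-reflexive (cong suc (sum-zero (λ i → ind-no (P? (suc i)) (λ pᵢ → 0≢suc (unique p₀ pᵢ)))))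
  where
  0≢suc : ∀ {i : Fin n} → zero ≢ suc i
  0≢suc ()
... | no  _  = sum-ind-unique (P? ∘ suc) (λ px py → sucᶠ-injective (unique px py))

sum-ind≤ind : ∀ {n} {P : Fin n → Set} {Q : Set} (P? : Decidable P) (Q? : Dec Q) →
              (∀ x → P x → Q) → (∀ {x y} → P x → P y → x ≡ y) → sum (ind ∘ P?) ≤ ind Q?
sum-ind≤ind P? (yes _) _   unique = sum-ind-unique P? unique
sum-ind≤ind P? (no ¬q) P⇒Q _      = ≤-reflexive (sum-zero (λ i → ind-no (P? i) (¬q ∘ P⇒Q i)))

module _ {n} (f : Fin n → ℕ) where

  private
    point : Fin n → Fin n → ℕ
    point j i = ind (i ≟ᶠ j)

    sum-point : ∀ j → sum (point j) ≤ 1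
    sum-point j = sum-ind-unique (_≟ᶠ j) (λ x≡j y≡j → trans x≡j (sym y≡j))

    common-zero : ∀ g → sum g + sum f < n → ∃[ i ] f i ≡ 0 × g i ≡ 0
    common-zero g few with i , gi+fi≡0 ← sum<⇒zero-term (λ i → g i + f i)
                             (≤-<-trans (≤-reflexive (∑-distrib-+ g f)) few) =
      i , m+n≡0⇒n≡0 (g i) gi+fi≡0 , m+n≡0⇒m≡0 (g i) gi+fi≡0

    half-bound : ∀ {s} c e → s + s ≤ c + n → e + e + c < n → e + s < n
    half-bound {s} c e 2s≤c+n 2e+c<n = ≰⇒> (λ n≤e+s → <⇒≱ 2e+c<n (+-cancelʳ-≤ n _ _ (begin
      n + n                ≤⟨ +-mono-≤ n≤e+s n≤e+s ⟩
      e + s + (e + s)      ≡⟨ regroup e s ⟩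
      e + e + (s + s)      ≤⟨ +-monoʳ-≤ (e + e) 2s≤c+n ⟩
      e + e + (c + n)      ≡⟨ +-assoc (e + e) c n ⟨
      e + e + c + n        ∎)))
      where
      open ≤-Reasoning
      regroup : ∀ e s → e + s + (e + s) ≡ e + e + (s + s)
      regroup = solve-∀

  -- Each excluded index adds to `f` an indicator of sum at most 1. The enlarged sum is still below
  -- `n`, so one of its terms vanishes.
  zero-term-avoiding₁ : 4 ≤ n → sum f + sum f ≤ suc n → ∀ j → ∃[ i ] f i ≡ 0 × i ≢ j
  zero-term-avoiding₁ 4≤n 2s≤1+n j with i , fi≡0 , pi≡0 ← common-zero (point j)
      (≤-<-trans (+-monoˡ-≤ _ (sum-point j)) (half-bound 1 1 2s≤1+n 4≤n)) =
    i , fi≡0 , ind≡0⇒¬ (i ≟ᶠ j) pi≡0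

  zero-term-avoiding₂ : 5 ≤ n → sum f + sum f ≤ n → ∀ j k → ∃[ i ] f i ≡ 0 × i ≢ j × i ≢ k
  zero-term-avoiding₂ 5≤n 2s≤n j k with i , fi≡0 , pi≡0 ← common-zero (λ i → point j i + point k i)
      (≤-<-trans
        (+-monoˡ-≤ _ (≤-trans (≤-reflexive (∑-distrib-+ (point j) (point k))) (+-mono-≤ (sum-point j) (sum-point k))))
        (half-bound 0 2 2s≤n 5≤n)) =
    i , fi≡0 , ind≡0⇒¬ (i ≟ᶠ j) (m+n≡0⇒m≡0 _ pi≡0) , ind≡0⇒¬ (i ≟ᶠ k) (m+n≡0⇒n≡0 (point j i) pi≡0)

sum-↑ : ∀ m {n} (f : Fin (m + n) → ℕ) → sum f ≡ sum (f ∘ (_↑ˡ n)) + sum (f ∘ (m ↑ʳ_))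
sum-↑ zero    f = refl
sum-↑ (suc m) f = trans (cong (f zero +_) (sum-↑ m (f ∘ suc))) (sym (+-assoc (f zero) _ _))

-- Chronologies

module _ {V : Set} (E : V → V → Set) (t : V → ℕ) where

  -- Only inequalities are imposed: `x` may turn blue later than simultaneous forcing would allow. A
  -- schedule written down by hand thus qualifies without showing that no force could happen
  -- earlier.
  ForcedBy : V → V → Set
  ForcedBy u x = E u x × t u < t x × (∀ w → E u w → w ≢ x → t w < t x)

  -- t x is the time-step in which x turns blue, the blue set at the start being t ⁻¹ 0.
  IsChronology : Set
  IsChronology = ∀ x → t x ≡ 0 ⊎ ∃[ u ] ForcedBy u x

-- Blue sets of a graph versus chronologies

module Propagation (G : Graph) where
  open Graph G
  open ZeroForcing G hiding (IsZeroForcingSet; IsZeroForcingNumber; IsPropagationTimeOf)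

  ∈-forced⁺ : ∀ {S u x} → Forces S u x → x ∈ forced S
  ∈-forced⁺ {S} f = ∈-tabulate⁺ (λ x → any? (λ u → forces? S u x)) (_ , f)

  ∈-forced⁻ : ∀ {S x} → x ∈ forced S → ∃[ u ] Forces S u x
  ∈-forced⁻ {S} = ∈-tabulate⁻ (λ x → any? (λ u → forces? S u x))

  forces-mono : ∀ {S T u x} → S ⊆ T → x ∉ T → Forces S u x → Forces T u x
  forces-mono S⊆T x∉T (u∈S , _ , adj , only) =
    S⊆T u∈S , x∉T , adj , λ w uw w∉T → only w uw (w∉T ∘ S⊆T)

  blueAfter-mono : ∀ B {j k} → j ≤ k → blueAfter B j ⊆ blueAfter B k
  blueAfter-mono B {j} {k} j≤k with ≤⇒≤′ j≤k
  ... | j≤′k = go j≤′k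
    where
    open import Data.Nat using (_≤′_; ≤′-refl; ≤′-step)
    go : ∀ {k} → j ≤′ k → blueAfter B j ⊆ blueAfter B k
    go ≤′-refl        x∈ = x∈
    go (≤′-step j≤′k) x∈ = p⊆p∪q _ (go j≤′k x∈)

  -- A time-step is carried out one vertex at a time. A force available from `S` remains available
  -- from a larger `T` while its target is white, so the vertices of `xs` can be processed in any
  -- order.
  sequentialize : ∀ {S T} (xs : List Vertex) → S ⊆ T → T ⊆ S ∪ forced S →
    ∃[ U ] Star _⟶_ T U × T ⊆ U × U ⊆ S ∪ forced S × (∀ {x} → x List.∈ xs → x ∈ forced S → x ∈ U)
  sequentialize []       S⊆T T⊆S′ = _ , ε , (λ x∈ → x∈) , T⊆S′ , λ ()
  sequentialize {S} {T} (x ∷ xs) S⊆T T⊆S′ with x ∈? T | x ∈? forced S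
  ... | yes x∈T | _ =
    let U , steps , T⊆U , U⊆S′ , covers = sequentialize xs S⊆T T⊆S′ in
    U , steps , T⊆U , U⊆S′ , λ { (Any.here refl) _ → T⊆U x∈T ; (Any.there y∈) → covers y∈ }
  ... | no _ | no x∉f =
    let U , steps , T⊆U , U⊆S′ , covers = sequentialize xs S⊆T T⊆S′ in
    U , steps , T⊆U , U⊆S′ , λ { (Any.here refl) x∈f → contradiction x∈f x∉f ; (Any.there y∈) → covers y∈ }
  ... | no x∉T | yes x∈f =
    let u , f = ∈-forced⁻ {S} x∈f
        U , steps , T′⊆U , U⊆S′ , covers =
          sequentialize {S} {T ∪ ⁅ x ⁆} xs (p⊆p∪q ⁅ x ⁆ ∘ S⊆T)
            (λ y∈ → [ T⊆S′ , (λ y∈x → subst (_∈ _) (sym (x∈⁅y⁆⇒x≡y x y∈x)) (q⊆p∪q S _ x∈f)) ]′ (x∈p∪q⁻ T ⁅ x ⁆ y∈))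
    in U , force (forces-mono S⊆T x∉T f) ◅ steps , T′⊆U ∘ p⊆p∪q ⁅ x ⁆ , U⊆S′ ,
       λ { (Any.here refl) _ → T′⊆U (q⊆p∪q T _ (x∈⁅x⁆ x)) ; (Any.there y∈) → covers y∈ }

  time-step-reachable : ∀ S → Star _⟶_ S (S ∪ forced S)
  time-step-reachable S =
    let U , steps , S⊆U , U⊆S′ , covers = sequentialize {S} (allFin order) (λ x∈ → x∈) (p⊆p∪q (forced S)) in
    subst (Star _⟶_ S)
      (⊆-antisym U⊆S′ (λ {x} x∈ → [ S⊆U , covers (∈-allFin x) ]′ (x∈p∪q⁻ S (forced S) x∈)))
      steps

  blueAfter-reachable : ∀ B k → Star _⟶_ B (blueAfter B k)
  blueAfter-reachable B zero    = ε
  blueAfter-reachable B (suc k) = blueAfter-reachable B k ◅◅ time-step-reachable (blueAfter B k)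

  reachable-bounded : ∀ {B S T} k → S ⊆ blueAfter B k → Star _⟶_ S T → ∃[ k′ ] T ⊆ blueAfter B k′
  reachable-bounded k S⊆ ε = k , S⊆
  reachable-bounded {B} {S} k S⊆ (force {u} {x} f ◅ steps) = reachable-bounded (suc k) S∪x⊆ steps
    where
    x∈next : x ∈ blueAfter B (suc k)
    x∈next with x ∈? blueAfter B k
    ... | yes x∈ = p⊆p∪q _ x∈
    ... | no  x∉ = q⊆p∪q (blueAfter B k) _ (∈-forced⁺ (forces-mono S⊆ x∉ f))

    S∪x⊆ : S ∪ ⁅ x ⁆ ⊆ blueAfter B (suc k)
    S∪x⊆ y∈ with x∈p∪q⁻ S ⁅ x ⁆ y∈
    ... | inj₁ y∈S = p⊆p∪q _ (S⊆ y∈S)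
    ... | inj₂ y∈x rewrite x∈⁅y⁆⇒x≡y x y∈x = x∈next

  ⊤⊆⇒≡⊤ : ∀ {S : Subset order} → ⊤ ⊆ S → S ≡ ⊤
  ⊤⊆⇒≡⊤ ⊤⊆S = ⊆-antisym (λ _ → ∈⊤) ⊤⊆S

  zeroForcingSet⇒blueAfter≡⊤ : ∀ {B} → IsZeroForcingSet G B → ∃[ k ] blueAfter B k ≡ ⊤
  zeroForcingSet⇒blueAfter≡⊤ steps =
    let k , ⊤⊆ = reachable-bounded 0 (λ x∈ → x∈) steps in k , ⊤⊆⇒≡⊤ ⊤⊆

  blueAfter≡⊤⇒zeroForcingSet : ∀ {B k} → blueAfter B k ≡ ⊤ → IsZeroForcingSet G B
  blueAfter≡⊤⇒zeroForcingSet {B} {k} eq = subst (Star _⟶_ B) eq (blueAfter-reachable B k)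

  module _ (B : Subset order) where

    -- The search runs down from a time `k` by which `x` should be blue; as the blue sets increase,
    -- it may stop at the first one that misses `x`.
    firstBlue : Vertex → ℕ → ℕ
    firstBlue x zero    = 0
    firstBlue x (suc k) with x ∈? blueAfter B k
    ... | yes _ = firstBlue x k
    ... | no  _ = suc k

    firstBlue≤ : ∀ x k → firstBlue x k ≤ k
    firstBlue≤ x zero    = z≤n
    firstBlue≤ x (suc k) with x ∈? blueAfter B k
    ... | yes _ = m≤n⇒m≤1+n (firstBlue≤ x k)
    ... | no  _ = ≤-refl

    ∈-firstBlue : ∀ {x} k → x ∈ blueAfter B k → x ∈ blueAfter B (firstBlue x k)
    ∈-firstBlue zero    x∈ = x∈
    ∈-firstBlue {x} (suc k) x∈ with x ∈? blueAfter B k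
    ... | yes x∈k = ∈-firstBlue k x∈k
    ... | no  _   = x∈

    firstBlue-least : ∀ {x j} k → x ∈ blueAfter B j → firstBlue x k ≤ j
    firstBlue-least zero    x∈ = z≤n
    firstBlue-least {x} {j} (suc k) x∈ with x ∈? blueAfter B k
    ... | yes _   = firstBlue-least k x∈
    ... | no  x∉k = ≰⇒> (λ j≤k → x∉k (blueAfter-mono B j≤k x∈))

    -- The times of first blueness work: a vertex first blue at `suc k` is forced from the blue set
    -- of time `k`, which contains its forcer and all other neighbours of the forcer.
    chronology⁺ : ∀ {T} → blueAfter B T ≡ ⊤ →
      ∃[ t ] IsChronology Adj t × (∀ x → t x ≤ T) × ∣ B ∣ ≡ sum (λ x → ind (t x ≟ 0))
    chronology⁺ {T} eq = t , chronological , (λ x → firstBlue≤ x T) ,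
      ∣∣≡sum B (λ x → t x ≟ 0) (λ x∈B → n≤0⇒n≡0 (firstBlue-least T x∈B))
        (λ {x} tx≡0 → subst (λ k → x ∈ blueAfter B k) tx≡0 (blue x))
      where
      t : Vertex → ℕ
      t x = firstBlue x T

      blue : ∀ x → x ∈ blueAfter B (t x)
      blue x = ∈-firstBlue T (subst (x ∈_) (sym eq) ∈⊤)

      chronological : IsChronology Adj t
      chronological x with t x in tx | blue x
      ... | zero  | _ = inj₁ refl
      ... | suc k | x∈ =
        [ (λ x∈k → contradiction x∈k x∉k) , forcer ∘ ∈-forced⁻ ]′ (x∈p∪q⁻ (blueAfter B k) _ x∈)
        where
        x∉k : x ∉ blueAfter B k
        x∉k x∈k = 1+n≰n (≤-trans (≤-reflexive (sym tx)) (firstBlue-least T x∈k))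

        forcer : ∃[ u ] Forces (blueAfter B k) u x →
                 suc k ≡ 0 ⊎ ∃[ u ] (Adj u x × t u < suc k × (∀ w → Adj u w → w ≢ x → t w < suc k))
        forcer (u , u∈ , _ , ux , only) = inj₂ (u , ux , s≤s (firstBlue-least T u∈) ,
          λ w uw w≢x → s≤s (firstBlue-least T (decidable-stable (w ∈? _) (λ w∉ → w≢x (only w uw w∉)))))

  module _ {t : Vertex → ℕ} (chronological : IsChronology Adj t) where

    initial : Subset order
    initial = tabulate (λ x → does (t x ≟ 0))

    -- Simultaneous forcing is never slower than a chronology: by induction the forcer of `x` and
    -- its other neighbours are blue at time `k`, so `x` is blue at time `suc k`.
    chronology⇒blueAfter : ∀ k {x} → t x ≤ k → x ∈ blueAfter initial k
    chronology⇒blueAfter zero    tx≤0 = ∈-tabulate⁺ (λ x → t x ≟ 0) (n≤0⇒n≡0 tx≤0)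
    chronology⇒blueAfter (suc k) {x} tx≤ with x ∈? blueAfter initial k | chronological x
    ... | yes x∈ | _ = p⊆p∪q _ x∈
    ... | no  _  | inj₁ tx≡0 = p⊆p∪q _ (chronology⇒blueAfter k (subst (_≤ k) (sym tx≡0) z≤n))
    ... | no  x∉ | inj₂ (u , ux , tu<tx , others) =
      q⊆p∪q (blueAfter initial k) _ (∈-forced⁺ (before tu<tx , x∉ , ux ,
        λ w uw w∉ → decidable-stable (w ≟ᶠ x) (λ w≢x → w∉ (before (others w uw w≢x)))))
      where
      before : ∀ {w} → t w < t x → w ∈ blueAfter initial k
      before tw<tx = chronology⇒blueAfter k (s≤s⁻¹ (≤-trans tw<tx tx≤))
        where open import Data.Nat using (s≤s⁻¹)

    chronology⇒blueAfter≡⊤ : ∀ {T} → (∀ x → t x ≤ T) → blueAfter initial T ≡ ⊤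
    chronology⇒blueAfter≡⊤ {T} t≤T = ⊤⊆⇒≡⊤ (λ {x} _ → chronology⇒blueAfter T (t≤T x))

    ∣initial∣ : ∣ initial ∣ ≡ sum (λ x → ind (t x ≟ 0))
    ∣initial∣ = ∣∣≡sum initial (λ x → t x ≟ 0) (∈-tabulate⁻ (λ x → t x ≟ 0)) (∈-tabulate⁺ (λ x → t x ≟ 0))

module _ {V W : Set} (e : V ↔ W) {E : W → W → Set} where
  open Inverse e using (to; from; strictlyInverseˡ; strictlyInverseʳ)

  chronology-pullback : ∀ {t} → IsChronology E t → IsChronology (E on to) (t ∘ to)
  chronology-pullback {t} chronological x with chronological (to x)
  ... | inj₁ tx≡0 = inj₁ tx≡0
  ... | inj₂ (u , ux , tu<tx , others) = inj₂ (from u ,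
    subst (λ u → E u (to x)) (sym (strictlyInverseˡ u)) ux ,
    subst (λ u → t u < t (to x)) (sym (strictlyInverseˡ u)) tu<tx ,
    λ w uw w≢x → others (to w) (subst (λ u → E u (to w)) (strictlyInverseˡ u) uw) (w≢x ∘ to-injective))
    where
    to-injective : ∀ {x y} → to x ≡ to y → x ≡ y
    to-injective eq = trans (sym (strictlyInverseʳ _)) (trans (cong from eq) (strictlyInverseʳ _))

  chronology-pushforward : ∀ {t} → IsChronology (E on to) t → IsChronology E (t ∘ from)
  chronology-pushforward {t} chronological y with chronological (from y)
  ... | inj₁ tx≡0 = inj₁ tx≡0
  ... | inj₂ (u , ux , tu<tx , others) = inj₂ (to u ,
    subst (E (to u)) (strictlyInverseˡ y) ux ,
    subst (λ u → t u < t (from y)) (sym (strictlyInverseʳ u)) tu<tx ,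
    λ w uw w≢y → others (from w) (subst (E (to u)) (sym (strictlyInverseˡ w)) uw)
      (λ eq → w≢y (trans (sym (strictlyInverseˡ w)) (trans (cong to eq) (strictlyInverseˡ y)))))

-- Forcers in a chronology and their number

module Forcers {V : Set} {E : V → V → Set} {t : V → ℕ} (chronological : IsChronology E t) where

  -- One forcer is fixed for every vertex. The value `x` for an initially blue `x` is a dummy, which
  -- `0 < t x` in `_⇝_` rules out.
  parent : V → V
  parent x = [ (λ _ → x) , proj₁ ]′ (chronological x)

  _⇝_ : V → V → Set
  u ⇝ x = 0 < t x × parent x ≡ u

  Source : V → Set
  Source u = ∃[ x ] u ⇝ x

  forcer : ∀ {x} → 0 < t x → ∃[ u ] u ⇝ x
  forcer 0<tx = _ , 0<tx , refl

  ⇝⇒forcedBy : ∀ {u x} → u ⇝ x → ForcedBy E t u x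
  ⇝⇒forcedBy {u} {x} (0<tx , refl) with chronological x
  ... | inj₁ tx≡0    = contradiction tx≡0 (>⇒≢ 0<tx)
  ... | inj₂ (u , f) = f

  ⇝⇒adjacent : ∀ {u x} → u ⇝ x → E u x
  ⇝⇒adjacent = proj₁ ∘ ⇝⇒forcedBy

  ⇝⇒< : ∀ {u x} → u ⇝ x → t u < t x
  ⇝⇒< = proj₁ ∘ proj₂ ∘ ⇝⇒forcedBy

  ⇝⇒others< : ∀ {u x} → u ⇝ x → ∀ {w} → E u w → w ≢ x → t w < t x
  ⇝⇒others< ux = proj₂ (proj₂ (⇝⇒forcedBy ux)) _

  ⇝-injective : ∀ {u w x} → u ⇝ x → w ⇝ x → u ≡ w
  ⇝-injective (_ , refl) (_ , refl) = refl

  module Counting {N : ℕ} (e : Fin N ↔ V) where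
    open Inverse e using (to; from; strictlyInverseˡ; strictlyInverseʳ)

    _≟ᵛ_ : (x y : V) → Dec (x ≡ y)
    x ≟ᵛ y = map′ (λ eq → trans (sym (strictlyInverseˡ x)) (trans (cong to eq) (strictlyInverseˡ y)))
                  (cong from) (from x ≟ᶠ from y)

    -- If `u` forced two different vertices, each would have to be blue before the other.
    ⇝-functional : ∀ {u x y} → u ⇝ x → u ⇝ y → x ≡ y
    ⇝-functional {u} {x} {y} ux uy = decidable-stable (x ≟ᵛ y) (λ x≢y →
      <-asym (⇝⇒others< ux (⇝⇒adjacent uy) (x≢y ∘ sym)) (⇝⇒others< uy (⇝⇒adjacent ux) x≢y))

    opaque
      _⇝?_ : ∀ u x → Dec (u ⇝ x)
      u ⇝? x = (0 <? t x) ×-dec (parent x ≟ᵛ u)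

      source? : ∀ u → Dec (Source u)
      source? u = map′ (λ (i , u⇝) → to i , u⇝)
                       (λ (x , u⇝x) → from x , subst (u ⇝_) (sym (strictlyInverseˡ x)) u⇝x)
                       (any? (λ i → u ⇝? to i))

      total : (V → ℕ) → ℕ
      total f = sum (f ∘ to)

      total≡sum : ∀ f → total f ≡ sum (f ∘ to)
      total≡sum f = refl

      total-+ : ∀ f g → total (λ x → f x + g x) ≡ total f + total g
      total-+ f g = ∑-distrib-+ (f ∘ to) (g ∘ to)

      term≤total : ∀ f x → f x ≤ total f
      term≤total f x = ≤-trans (≤-reflexive (cong f (sym (strictlyInverseˡ x)))) (term≤sum (f ∘ to) (from x))

      two-terms≤total : ∀ f {x y} → x ≢ y → f x + f y ≤ total f
      two-terms≤total f {x} {y} x≢y = ≤-trans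
        (≤-reflexive (cong₂ _+_ (cong f (sym (strictlyInverseˡ x))) (cong f (sym (strictlyInverseˡ y)))))
        (two-terms≤sum (f ∘ to) (λ eq →
          x≢y (trans (sym (strictlyInverseˡ x)) (trans (cong to eq) (strictlyInverseˡ y)))))

      total-complement : ∀ {P : V → Set} (P? : Decidable P) → total (λ x → ind (¬? (P? x))) + total (ind ∘ P?) ≡ N
      total-complement P? = trans (sym (∑-distrib-+ (λ i → ind (¬? (P? (to i)))) (λ i → ind (P? (to i)))))
        (trans (sum-cong-≗ (λ i → ind-¬ (P? (to i)))) (sum-one N))

      -- Every vertex that is not initially blue has a forcer, and no two of them share one.
      forced≤sources : total (λ x → ind (¬? (t x ≟ 0))) ≤ total (ind ∘ source?)
      forced≤sources = begin
        total (λ x → ind (¬? (t x ≟ 0)))                  ≤⟨ sum-mono (has-forcer ∘ to) ⟩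
        total (λ x → total (λ u → ind (u ⇝? x)))          ≡⟨ ∑-comm (λ i j → ind (to j ⇝? to i)) ⟩
        total (λ u → total (λ x → ind (u ⇝? x)))          ≤⟨ sum-mono (forces-once ∘ to) ⟩
        total (ind ∘ source?)                             ∎
        where
        open ≤-Reasoning

        has-forcer : ∀ x → ind (¬? (t x ≟ 0)) ≤ total (λ u → ind (u ⇝? x))
        has-forcer x = ind≤ (¬? (t x ≟ 0)) (λ tx≢0 → ≤-trans
          (≤-reflexive (sym (ind-yes (to (from (parent x)) ⇝? x)
            (n≢0⇒n>0 tx≢0 , sym (strictlyInverseˡ (parent x))))))
          (term≤sum (λ i → ind (to i ⇝? x)) (from (parent x))))

        forces-once : ∀ u → total (λ x → ind (u ⇝? x)) ≤ ind (source? u)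
        forces-once u = sum-ind≤ind (λ i → u ⇝? to i) (source? u) (λ i ui → to i , ui)
          (λ ui uj → trans (sym (strictlyInverseʳ _))
            (trans (cong from (⇝-functional ui uj)) (strictlyInverseʳ _)))

      -- Take complements of both sides of `forced≤sources` among the `N` vertices. This inequality
      -- is what limits the defects below.
      nonsources≤initial : total (λ u → ind (¬? (source? u))) ≤ total (λ x → ind (t x ≟ 0))
      nonsources≤initial = +-cancelʳ-≤ (total (ind ∘ source?)) _ _ (begin
        total (λ u → ind (¬? (source? u))) + total (ind ∘ source?)         ≡⟨ total-complement source? ⟩
        N                                                                  ≡⟨ total-complement (λ x → t x ≟ 0) ⟨
        total (λ x → ind (¬? (t x ≟ 0))) + total (λ x → ind (t x ≟ 0))     ≤⟨ +-monoˡ-≤ _ forced≤sources ⟩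
        total (ind ∘ source?) + total (λ x → ind (t x ≟ 0))                ≡⟨ +-comm (total (ind ∘ source?)) _ ⟩
        total (λ x → ind (t x ≟ 0)) + total (ind ∘ source?)                ∎)
        where open ≤-Reasoning

-- The rim

next : ∀ {n} → Fin n → Fin n
next i with view i
... | ‵fromℕ     = zero
... | ‵inject₁ j = suc j

prev : ∀ {n} → Fin n → Fin n
prev (zero {n}) = fromℕ n
prev (suc i)    = inject₁ i

next∘prev : ∀ {n} (i : Fin n) → next (prev i) ≡ i
next∘prev (zero {n})      rewrite view-fromℕ n   = refl
next∘prev {suc (suc n)} (suc i) rewrite view-inject₁ i = refl

prev∘next : ∀ {n} (i : Fin n) → prev (next i) ≡ i
prev∘next i with view i
... | ‵fromℕ  = refl
... | ‵inj₁ _ = refl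

rotation : ∀ n → Permutation′ n
rotation n = permutation next prev next∘prev prev∘next

sum-next : ∀ {n} (f : Fin n → ℕ) → sum (f ∘ next) ≡ sum f
sum-next {n} f = sym (sum-permute f (rotation n))

prev∘prev≢id : ∀ {n} → 3 ≤ n → (i : Fin n) → prev (prev i) ≢ i
prev∘prev≢id (s≤s (s≤s (s≤s _))) zero          ()
prev∘prev≢id (s≤s (s≤s (s≤s _))) (suc zero)    ()
prev∘prev≢id (s≤s (s≤s (s≤s _))) (suc (suc i)) eq = <⇒≢ (m<n+m (toℕ i) {2} (s≤s z≤n))
  (trans (sym (trans (toℕ-inject₁ (inject₁ i)) (toℕ-inject₁ i))) (cong toℕ eq))

-- Otherwise two steps back along the rim would lead to the start. Hence a spoke that forces along
-- the rim has exactly one rim neighbour besides its target.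
next≢prev : ∀ {n} → 3 ≤ n → (i : Fin n) → next i ≢ prev i
next≢prev 3≤n i eq = prev∘prev≢id 3≤n i (trans (cong prev (sym eq)) (prev∘next i))

-- The helm graph

infix 4 _~_
_~_ : ∀ {m} → HelmVertex m → HelmVertex m → Set
_~_ {m} = SymClosure (HelmEdge m)

~-sym : ∀ {m} → Symmetric (_~_ {m})
~-sym = symmetric _

v₀~v : ∀ {m} {i : Fin m} → v₀ ~ v i
v₀~v = fwd (spoke _)

v~p : ∀ {m} {i : Fin m} → v i ~ p i
v~p = fwd (pendant _)

p~ : ∀ {m} {i : Fin m} {x} → p i ~ x → x ≡ v i
p~ (bwd (pendant _)) = refl

v₀~ : ∀ {m} {x : HelmVertex m} → v₀ ~ x → ∃[ i ] x ≡ v i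
v₀~ (fwd (spoke i)) = i , refl

v₀≢v : ∀ {m} {i : Fin m} → v₀ ≢ v i
v₀≢v ()

v₀≢p : ∀ {m} {i : Fin m} → v₀ ≢ p i
v₀≢p ()

v≢p : ∀ {m} {i j : Fin m} → v i ≢ p j
v≢p ()

v-injective : ∀ {m} {i j : Fin m} → v i ≡ v j → i ≡ j
v-injective refl = refl

rim⇒prev : ∀ {n} {i j : Fin n} → toℕ j ≡ suc (toℕ i) → i ≡ prev j
rim⇒prev {j = suc j} eq = toℕ-injective (trans (sym (cong pred eq)) (sym (toℕ-inject₁ j)))

closing⇒prev : ∀ {n} {i j : Fin n} → toℕ i ≡ 0 → suc (toℕ j) ≡ n → j ≡ prev i
closing⇒prev {i = zero {n}} _ eq = toℕ-injective (trans (cong pred eq) (sym (toℕ-fromℕ n)))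

v~v : ∀ {n} {i j : Fin n} → v i ~ v j → j ≡ next i ⊎ j ≡ prev i
v~v {j = j} (fwd (rim eq))      = inj₁ (trans (sym (next∘prev j)) (cong next (sym (rim⇒prev eq))))
v~v         (fwd (closing z l)) = inj₂ (closing⇒prev z l)
v~v         (bwd (rim eq))      = inj₂ (rim⇒prev eq)
v~v {j = j} (bwd (closing z l)) = inj₁ (trans (sym (next∘prev j)) (cong next (sym (closing⇒prev z l))))

v~v-prev : ∀ {n} (i : Fin n) → v i ~ v (prev i)
v~v-prev (zero {n}) = fwd (closing refl (cong suc (toℕ-fromℕ n)))
v~v-prev (suc i)    = bwd (rim (cong suc (sym (toℕ-inject₁ i))))

v~v-next : ∀ {n} (i : Fin n) → v i ~ v (next i)
v~v-next i = subst (λ j → v j ~ v (next i)) (prev∘next i) (~-sym (v~v-prev (next i)))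

sum-helm : ∀ m (f : HelmVertex m → ℕ) →
           sum (f ∘ Inverse.to (helmVertices m)) ≡ f v₀ + (sum (f ∘ v) + sum (f ∘ p))
sum-helm m f = cong (f v₀ +_) (trans (sum-↑ m (f ∘ to ∘ suc))
  (cong₂ _+_ (sum-cong-≗ (λ i → cong f (strictlyInverseˡ (v i))))
             (sum-cong-≗ (λ i → cong f (strictlyInverseˡ (p i))))))
  where open Inverse (helmVertices m) using (to; strictlyInverseˡ)

halve-predecessor : ∀ {s b m} → s < b → b + b ≡ suc m → s + s ≤ m
halve-predecessor {s} {b} {m} s<b 2b≡1+m = ≤-pred (begin
  suc s + s   ≤⟨ +-mono-≤ s<b (<⇒≤ s<b) ⟩
  b + b       ≡⟨ 2b≡1+m ⟩
  suc m       ∎)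
  where open ≤-Reasoning

-- For an indicator `f` this adds up the degrees in an induced subgraph of the rim. Shifting by
-- `next` turns the products with `prev` into those with `next`, so each edge is counted from both
-- ends.
2∣handshake : ∀ {n} (f : Fin n → ℕ) → 2 ∣ sum (λ i → f i * (f (next i) + f (prev i)))
2∣handshake f = subst (2 ∣_) (sym twice) (m∣m*n (sum (λ i → f i * f (next i))))
  where
  open ≡-Reasoning
  twice : sum (λ i → f i * (f (next i) + f (prev i))) ≡ 2 * sum (λ i → f i * f (next i))
  twice = begin
    sum (λ i → f i * (f (next i) + f (prev i)))
      ≡⟨ sum-cong-≗ (λ i → *-distribˡ-+ (f i) (f (next i)) (f (prev i))) ⟩
    sum (λ i → f i * f (next i) + f i * f (prev i))
      ≡⟨ ∑-distrib-+ (λ i → f i * f (next i)) (λ i → f i * f (prev i)) ⟩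
    sum (λ i → f i * f (next i)) + sum (λ i → f i * f (prev i))
      ≡⟨ cong (sum (λ i → f i * f (next i)) +_) (sum-next (λ i → f i * f (prev i))) ⟨
    sum (λ i → f i * f (next i)) + sum (λ i → f (next i) * f (prev (next i)))
      ≡⟨ cong (sum (λ i → f i * f (next i)) +_) (sum-cong-≗ (λ i →
           trans (cong (λ j → f (next i) * f j) (prev∘next i)) (*-comm (f (next i)) (f i)))) ⟩
    sum (λ i → f i * f (next i)) + sum (λ i → f i * f (next i))
      ≡⟨ cong (sum (λ i → f i * f (next i)) +_) (+-identityʳ _) ⟨
    2 * sum (λ i → f i * f (next i)) ∎

-- Forces in the helm graph

module HelmChronology {m : ℕ} (5≤m : 5 ≤ m) {t : HelmVertex m → ℕ} (chronological : IsChronology _~_ t) where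

  3≤m : 3 ≤ m
  3≤m = ≤-trans (m≤n+m 3 2) 5≤m

  open Forcers chronological
  open Counting (helmVertices m)

  private variable
    i j k w : Fin m

  -- The initial colour of the pendant, not of the spoke.
  Blue White : Fin m → Set
  Blue  i = t (p i) ≡ 0
  White i = 0 < t (p i)

  blue : Fin m → ℕ
  blue i = ind (t (p i) ≟ 0)

  ¬Blue⇒White : ¬ Blue i → White i
  ¬Blue⇒White = n≢0⇒n>0

  ¬White⇒Blue : ¬ White i → Blue i
  ¬White⇒Blue = n≤0⇒n≡0 ∘ ≮⇒≥

  White⇒v⇝p : White w → v w ⇝ p w
  White⇒v⇝p white with u , uw ← forcer white with refl ← p~ (~-sym (⇝⇒adjacent uw)) = uw

  v⇝v₀⇒Blue : v i ⇝ v₀ → Blue i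
  v⇝v₀⇒Blue i0 = ¬White⇒Blue (λ white → v₀≢p (sym (⇝-functional (White⇒v⇝p white) i0)))

  forcer-of-white : White w → 0 < t (v w) → v₀ ⇝ v w ⊎ ∃[ i ] v i ⇝ v w
  forcer-of-white {w} white 0<vw with forcer 0<vw
  ... | v₀  , 0w = inj₁ 0w
  ... | v i , iw = inj₂ (i , iw)
  ... | p i , iw with refl ← p~ (⇝⇒adjacent iw) = contradiction (⇝⇒< iw) (<-asym (⇝⇒< (White⇒v⇝p white)))

  -- If `v₀` does not force the spoke itself, a rim neighbour does, and that one has to wait for all
  -- its other neighbours, among them `v₀`.
  v₀<v-of-white : White w → 0 < t (v w) → t v₀ < t (v w)
  v₀<v-of-white white 0<vw with forcer-of-white white 0<vw
  ... | inj₁ 0w       = ⇝⇒< 0w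
  ... | inj₂ (i , iw) = ⇝⇒others< iw (~-sym v₀~v) (λ ())

  v<p-of-white : White w → t (v w) < t (p w)
  v<p-of-white = ⇝⇒< ∘ White⇒v⇝p

  opaque
    forcer-of-v₀ : 0 < t v₀ → ∃[ i ] v i ⇝ v₀
    forcer-of-v₀ 0<v₀ with forcer 0<v₀
    ... | u , u0 with i , refl ← v₀~ (~-sym (⇝⇒adjacent u0)) = i , u0

    target-of-v₀ : Source v₀ → ∃[ j ] v₀ ⇝ v j
    target-of-v₀ (x , 0x) with j , refl ← v₀~ (⇝⇒adjacent 0x) = j , 0x

  others-before-target-of-v₀ : v₀ ⇝ v j → i ≢ j → t (v i) < t (v j)
  others-before-target-of-v₀ 0j i≢j = ⇝⇒others< 0j v₀~v (i≢j ∘ v-injective)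

  target-of-p : Source (p i) → p i ⇝ v i
  target-of-p (x , ix) with refl ← p~ (⇝⇒adjacent ix) = ix

  target-of-blue : Blue i → Source (v i) → v i ⇝ v₀ ⊎ ∃[ j ] v i ⇝ v j
  target-of-blue blueᵢ (v₀  , i0) = inj₁ i0
  target-of-blue blueᵢ (v j , ij) = inj₂ (j , ij)
  target-of-blue blueᵢ (p j , ij) with refl ← p~ (~-sym (⇝⇒adjacent ij)) = contradiction blueᵢ (>⇒≢ (proj₁ ij))

  -- The forces out of the spokes with blue pendant happen at time θ at the latest, and the
  -- spokes with white pendant are blue at time θ at the earliest. Hence the spoke forcing v₀
  -- has two rim neighbours with blue pendant, and every other spoke with blue pendant has one.
  module Parity (θ : ℕ) (late : ∀ {w} → White w → θ ≤ t (v w))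
    (target : ∀ {i} → Blue i → (v i ⇝ v₀ × t v₀ ≤ θ) ⊎ ∃[ j ] v i ⇝ v j × White j × t (v j) ≤ θ)
    where

    forces-v₀ : Fin m → ℕ
    forces-v₀ i = ind (v i ⇝? v₀)

    early : t (v i) < θ → Blue i
    early vi<θ = ¬White⇒Blue (λ white → <⇒≱ vi<θ (late white))

    degree : ∀ i → blue i * (blue (next i) + blue (prev i)) ≡ blue i + forces-v₀ i
    degree i = by-colour (t (p i) ≟ 0)
      where
      by-colour : (d : Dec (Blue i)) → ind d * (blue (next i) + blue (prev i)) ≡ ind d + forces-v₀ i
      by-colour (no ¬blue) = sym (ind-no (v i ⇝? v₀) (¬blue ∘ v⇝v₀⇒Blue))
      by-colour (yes blueᵢ) = trans (+-identityʳ _) (by-target (target blueᵢ))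
        where
        by-target : (v i ⇝ v₀ × t v₀ ≤ θ) ⊎ ∃[ j ] v i ⇝ v j × White j × t (v j) ≤ θ →
                    blue (next i) + blue (prev i) ≡ 1 + forces-v₀ i
        -- Both rim neighbours of the forcer of `v₀` are blue before `v₀`, hence before `θ`, which
        -- is too early for a white pendant.
        by-target (inj₁ (i0 , v₀≤θ)) = trans
          (cong₂ _+_ (blue-neighbour (v~v-next i)) (blue-neighbour (v~v-prev i)))
          (cong suc (sym (ind-yes (v i ⇝? v₀) i0)))
          where
          blue-neighbour : v i ~ v j → blue j ≡ 1
          blue-neighbour {j} ij = ind-yes (t (p j) ≟ 0) (early (<-≤-trans (⇝⇒others< i0 ij (λ ())) v₀≤θ))
        -- The target accounts for the one white pendant; the other rim neighbour precedes the
        -- target and so is too early to have one.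
        by-target (inj₂ (j , ij , white , vj≤θ)) = trans
          (by-side (v~v (⇝⇒adjacent ij)))
          (cong suc (sym (ind-no (v i ⇝? v₀) (λ i0 → v₀≢v (⇝-functional i0 ij)))))
          where
          white-target : blue j ≡ 0
          white-target = ind-no (t (p j) ≟ 0) (>⇒≢ white)

          blue-neighbour : v i ~ v k → k ≢ j → blue k ≡ 1
          blue-neighbour {k} ik k≢j = ind-yes (t (p k) ≟ 0)
            (early (<-≤-trans (⇝⇒others< ij ik (k≢j ∘ v-injective)) vj≤θ))

          by-side : j ≡ next i ⊎ j ≡ prev i → blue (next i) + blue (prev i) ≡ 1
          by-side (inj₁ j≡next) = cong₂ _+_
            (trans (cong blue (sym j≡next)) white-target)
            (blue-neighbour (v~v-prev i) (λ prev≡j → next≢prev 3≤m i (sym (trans prev≡j j≡next))))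
          by-side (inj₂ j≡prev) = cong₂ _+_
            (blue-neighbour (v~v-next i) (λ next≡j → next≢prev 3≤m i (trans next≡j j≡prev)))
            (trans (cong blue (sym j≡prev)) white-target)

    forcers-of-v₀ : sum forces-v₀ ≡ ind (0 <? t v₀)
    forcers-of-v₀ = ≤-antisym
      (sum-ind≤ind (λ i → v i ⇝? v₀) (0 <? t v₀) (λ _ → proj₁) (λ i0 j0 → v-injective (⇝-injective i0 j0)))
      (ind≤ (0 <? t v₀) (λ 0<v₀ → let i , i0 = forcer-of-v₀ 0<v₀ in
        ≤-trans (≤-reflexive (sym (ind-yes (v i ⇝? v₀) i0))) (term≤sum forces-v₀ i)))

    -- Sum `degree` over the rim: the left side is even by the handshake lemma, and on the right the
    -- forcer of `v₀` adds 1 exactly if `v₀` is initially white.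
    parity : 2 ∣ sum blue + ind (0 <? t v₀)
    parity = subst (2 ∣_)
      (trans (sum-cong-≗ degree) (trans (∑-distrib-+ blue forces-v₀) (cong (sum blue +_) forcers-of-v₀)))
      (2∣handshake blue)

  -- Counting defects

  total-helm : ∀ f → total f ≡ f v₀ + (sum (f ∘ v) + sum (f ∘ p))
  total-helm f = trans (total≡sum f) (sum-helm m f)

  initially : HelmVertex m → ℕ
  initially x = ind (t x ≟ 0)

  idle : HelmVertex m → ℕ
  idle x = ind (¬? (source? x))

  -- Each pendant is initially blue or never forces anything; only both at once is a defect.
  -- As no more vertices are idle than initially blue, the total defect is at most 2 ∣B∣ - m.
  defect : HelmVertex m → ℕ
  defect (p i) = ind ((t (p i) ≟ 0) ×-dec ¬? (source? (p i)))
  defect x     = initially x + idle x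

  -- The case to exclude is an initially white pendant that forces: its only possible target is the
  -- spoke that forced it. So every pendant contributes at least 1 to the count, whatever the blue
  -- set.
  pendant-defect : ∀ i → initially (p i) + idle (p i) ≡ defect (p i) + 1
  pendant-defect i = go (t (p i) ≟ 0) (source? (p i)) (λ white → <-asym (v<p-of-white white) ∘ ⇝⇒< ∘ target-of-p)
    where
    go : (d : Dec (Blue i)) (e : Dec (Source (p i))) → (White i → ¬ Source (p i)) →
         ind d + ind (¬? e) ≡ ind (d ×-dec ¬? e) + 1
    go (yes _)    (yes _) _        = refl
    go (yes _)    (no _)  _        = refl
    go (no ¬blue) (yes s) ¬source  = contradiction s (¬source (¬Blue⇒White ¬blue))
    go (no _)     (no _)  _        = refl

  defect-total : total (λ x → initially x + idle x) ≡ total defect + m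
  defect-total = begin
    total (λ x → initially x + idle x)
      ≡⟨ total-helm (λ x → initially x + idle x) ⟩
    defect v₀ + (sum (defect ∘ v) + sum (λ i → initially (p i) + idle (p i)))
      ≡⟨ cong (λ s → defect v₀ + (sum (defect ∘ v) + s)) (trans (sum-cong-≗ pendant-defect)
           (trans (∑-distrib-+ (defect ∘ p) (λ _ → 1)) (cong (sum (defect ∘ p) +_) (sum-one m)))) ⟩
    defect v₀ + (sum (defect ∘ v) + (sum (defect ∘ p) + m))
      ≡⟨ assoc (defect v₀) (sum (defect ∘ v)) (sum (defect ∘ p)) m ⟩
    defect v₀ + (sum (defect ∘ v) + sum (defect ∘ p)) + m
      ≡⟨ cong (_+ m) (total-helm defect) ⟨
    total defect + m ∎
    where
    open ≡-Reasoning
    assoc : ∀ a b c d → a + (b + (c + d)) ≡ a + (b + c) + d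
    assoc = solve-∀

  total-defect≤ : total defect + m ≤ total initially + total initially
  total-defect≤ = begin
    total defect + m                     ≡⟨ defect-total ⟨
    total (λ x → initially x + idle x)   ≡⟨ total-+ initially idle ⟩
    total initially + total idle         ≤⟨ +-monoʳ-≤ (total initially) nonsources≤initial ⟩
    total initially + total initially    ∎
    where open ≤-Reasoning

  defect-v₀⇒ : defect v₀ ≡ 0 → 0 < t v₀ × Source v₀
  defect-v₀⇒ d≡0 = n≢0⇒n>0 (ind≡0⇒¬ (t v₀ ≟ 0) (m+n≡0⇒m≡0 _ d≡0)) ,
                   ind-¬≡0⇒ (source? v₀) (m+n≡0⇒n≡0 (initially v₀) d≡0)

  defect-v⇒ : defect (v i) ≡ 0 → 0 < t (v i) × Source (v i)
  defect-v⇒ {i} d≡0 = n≢0⇒n>0 (ind≡0⇒¬ (t (v i) ≟ 0) (m+n≡0⇒m≡0 _ d≡0)) ,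
                      ind-¬≡0⇒ (source? (v i)) (m+n≡0⇒n≡0 (initially (v i)) d≡0)

  defect-p⇒ : defect (p i) ≡ 0 → Blue i → Source (p i)
  defect-p⇒ {i} d≡0 blueᵢ = decidable-stable (source? (p i))
    (λ idleᵢ → ind≡0⇒¬ ((t (p i) ≟ 0) ×-dec ¬? (source? (p i))) d≡0 (blueᵢ , idleᵢ))

  -- A blue pendant without defect forces something, which can only be its spoke; it would then be a
  -- second forcer of that spoke.
  white-target : ∀ {u} → defect (p j) ≡ 0 → u ⇝ v j → u ≢ p j → White j
  white-target d≡0 uj u≢p = ¬Blue⇒White (λ blueⱼ → u≢p (⇝-injective uj (target-of-p (defect-p⇒ d≡0 blueⱼ))))

  single-defect : total defect ≤ 1 → ∀ {x y} → x ≢ y → 0 < defect x → defect y ≡ 0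
  single-defect Δ≤1 x≢y 0<x = n≤0⇒n≡0 (+-cancelˡ-≤ 1 _ _
    (≤-trans (+-monoˡ-≤ _ 0<x) (≤-trans (two-terms≤total defect x≢y) Δ≤1)))

  total-initially : total initially ≡ initially v₀ + (sum (initially ∘ v) + sum blue)
  total-initially = total-helm initially

  no-blue-spokes : (∀ i → 0 < t (v i)) → sum (initially ∘ v) ≡ 0
  no-blue-spokes 0<v = sum-zero (λ i → ind-no (t (v i) ≟ 0) (>⇒≢ (0<v i)))

  opaque
    white-avoiding₁ : sum blue + sum blue ≤ suc m → ∀ j → ∃[ w ] White w × w ≢ j
    white-avoiding₁ 2s≤1+m j =
      let w , bw≡0 , w≢j = zero-term-avoiding₁ blue (≤-trans (n≤1+n 4) 5≤m) 2s≤1+m j in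
      w , ¬Blue⇒White (ind≡0⇒¬ (t (p w) ≟ 0) bw≡0) , w≢j

    white-avoiding₂ : sum blue + sum blue ≤ m → ∀ j k → ∃[ w ] White w × w ≢ j × w ≢ k
    white-avoiding₂ 2s≤m j k =
      let w , bw≡0 , w≢j , w≢k = zero-term-avoiding₂ blue 5≤m 2s≤m j k in
      w , ¬Blue⇒White (ind≡0⇒¬ (t (p w) ≟ 0) bw≡0) , w≢j , w≢k

  -- Lower bounds for the number of time-steps

  module Bounds {T : ℕ} (t≤T : ∀ x → t x ≤ T) where

    late-forces : (∀ i → 0 < t (v i)) → 2 ≤ t v₀ → ∀ {w} → White w → 3 ≤ t (v w)
    late-forces 0<v 2≤v₀ white = ≤-trans (s≤s 2≤v₀) (v₀<v-of-white white (0<v _))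

    2≤v₀ : (v i ⇝ v₀) → 0 < t (v i) → 2 ≤ t v₀
    2≤v₀ i0 0<vi = ≤-trans (s≤s 0<vi) (⇝⇒< i0)

    suc∣ : 0 < t v₀ → total initially ≡ sum blue → 2 ∣ sum blue + ind (0 <? t v₀) → 2 ∣ suc (total initially)
    suc∣ 0<v₀ eq = subst (2 ∣_)
      (trans (cong (sum blue +_) (ind-yes (0 <? t v₀) 0<v₀)) (trans (+-comm (sum blue) 1) (cong suc (sym eq))))

    all-blue-pendants : 0 < t v₀ → (∀ i → 0 < t (v i)) → total initially ≡ sum blue
    all-blue-pendants 0<v₀ 0<v = trans total-initially
      (cong₂ (λ a b → a + (b + sum blue)) (ind-no (t v₀ ≟ 0) (>⇒≢ 0<v₀)) (no-blue-spokes 0<v))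

    -- There is no room for a defect. At the earliest, `v₀` is forced at time 2, a spoke with white
    -- pendant other than `last` at 3, `last` by `v₀` at 4 and its pendant at 5. If `T` is 5, all
    -- spokes but `last` are blue by time 3, so `Parity` applies with `θ` equal to 3.
    even-bounds : total initially + total initially ≡ m →
                  5 ≤ T × (T ≤ 5 → 2 ∣ suc (total initially))
    even-bounds 2B≡m = 5≤T , λ T≤5 → suc∣ 0<v₀ B≡S (Tight.parity T≤5)
      where
      sound : ∀ x → defect x ≡ 0
      sound x = n≤0⇒n≡0 (≤-trans (term≤total defect x)
        (+-cancelʳ-≤ m _ 0 (≤-trans total-defect≤ (≤-reflexive 2B≡m))))

      0<v₀ : 0 < t v₀
      0<v₀ = proj₁ (defect-v₀⇒ (sound v₀))

      0<v : ∀ i → 0 < t (v i)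
      0<v i = proj₁ (defect-v⇒ (sound (v i)))

      B≡S : total initially ≡ sum blue
      B≡S = all-blue-pendants 0<v₀ 0<v

      late : ∀ {w} → White w → 3 ≤ t (v w)
      late = late-forces 0<v (2≤v₀ (proj₂ (forcer-of-v₀ 0<v₀)) (0<v _))

      v₀-target : ∃[ j ] v₀ ⇝ v j
      v₀-target = target-of-v₀ (proj₂ (defect-v₀⇒ (sound v₀)))

      last : Fin m
      last = proj₁ v₀-target

      white-last : White last
      white-last = white-target (sound (p last)) (proj₂ v₀-target) v₀≢p

      before-last : i ≢ last → t (v i) < t (v last)
      before-last = others-before-target-of-v₀ (proj₂ v₀-target)

      other : ∃[ w ] White w × w ≢ last × w ≢ last
      other = white-avoiding₂ (≤-reflexive (trans (sym (cong₂ _+_ B≡S B≡S)) 2B≡m)) last last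

      white-other : White (proj₁ other)
      white-other = proj₁ (proj₂ other)

      other≢last : proj₁ other ≢ last
      other≢last = proj₁ (proj₂ (proj₂ other))

      5≤T : 5 ≤ T
      5≤T = ≤-trans (s≤s (≤-trans (s≤s (late white-other)) (before-last other≢last)))
        (≤-trans (v<p-of-white white-last) (t≤T (p last)))

      module Tight (T≤5 : T ≤ 5) where
        v≤3 : i ≢ last → t (v i) ≤ 3
        v≤3 i≢last = ≤-pred (≤-trans (before-last i≢last)
          (≤-pred (≤-trans (v<p-of-white white-last) (≤-trans (t≤T (p last)) T≤5))))

        target : ∀ {i} → Blue i → (v i ⇝ v₀ × t v₀ ≤ 3) ⊎ ∃[ j ] v i ⇝ v j × White j × t (v j) ≤ 3
        target {i} blueᵢ with target-of-blue blueᵢ (proj₂ (defect-v⇒ (sound (v i))))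
        ... | inj₁ i0 = inj₁ (i0 ,
          <⇒≤ (<-≤-trans (v₀<v-of-white white-other (0<v _)) (v≤3 other≢last)))
        -- The spoke `last` is forced by `v₀` and hence not by `v i`, so `v≤3` covers the target.
        ... | inj₂ (j , ij) = inj₂ (j , ij , white-target (sound (p j)) ij v≢p ,
          v≤3 (λ j≡last → v₀≢v (⇝-injective (proj₂ v₀-target) (subst (λ j → v i ⇝ v j) j≡last ij))))

        open Parity 3 late target public using (parity)

    -- One defect is now possible. The cases below differ in what is initially blue: the hub, some
    -- spoke, or pendants only. In the first two cases that vertex uses up the defect.
    module Odd (2B≡1+m : total initially + total initially ≡ suc m) where

      Δ≤1 : total defect ≤ 1
      Δ≤1 = +-cancelʳ-≤ m _ 1 (≤-trans total-defect≤ (≤-reflexive 2B≡1+m))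

      -- A spoke with white pendant other than `last` is forced by a spoke that is itself not
      -- initially blue, so its earliest time is 2; `last` then comes at 3 and its pendant at 4. The
      -- threshold for `Parity` drops to 2 accordingly.
      module BlueHub (v₀≡0 : t v₀ ≡ 0) where

        hub-defect : initially v₀ ≡ 1
        hub-defect = ind-yes (t v₀ ≟ 0) v₀≡0

        sound : ∀ {x} → v₀ ≢ x → defect x ≡ 0
        sound v₀≢x = single-defect Δ≤1 v₀≢x (≤-trans (≤-reflexive (sym hub-defect)) (m≤m+n _ _))

        hub-source : Source v₀
        hub-source = ind-¬≡0⇒ (source? v₀) (n≤0⇒n≡0 (+-cancelˡ-≤ 1 _ _
          (≤-trans (≤-reflexive (cong (_+ idle v₀) (sym hub-defect))) (≤-trans (term≤total defect v₀) Δ≤1))))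

        0<v : ∀ i → 0 < t (v i)
        0<v i = proj₁ (defect-v⇒ (sound v₀≢v))

        B≡1+S : total initially ≡ suc (sum blue)
        B≡1+S = trans total-initially (cong₂ (λ a b → a + (b + sum blue)) hub-defect (no-blue-spokes 0<v))

        2S≤m : sum blue + sum blue ≤ m
        2S≤m = halve-predecessor (≤-reflexive (sym B≡1+S)) 2B≡1+m

        v₀-target : ∃[ j ] v₀ ⇝ v j
        v₀-target = target-of-v₀ hub-source

        last : Fin m
        last = proj₁ v₀-target

        white-last : White last
        white-last = white-target (sound v₀≢p) (proj₂ v₀-target) v₀≢p

        before-last : i ≢ last → t (v i) < t (v last)
        before-last = others-before-target-of-v₀ (proj₂ v₀-target)

        late-other : White w → w ≢ last → 2 ≤ t (v w)
        late-other {w} white w≢last =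
          [ (λ 0w → contradiction (v-injective (⇝-functional 0w (proj₂ v₀-target))) w≢last)
          , (λ (i , iw) → ≤-trans (s≤s (0<v i)) (⇝⇒< iw)) ]′ (forcer-of-white white (0<v w))

        other : ∃[ w ] White w × w ≢ last × w ≢ last
        other = white-avoiding₂ 2S≤m last last

        late-last : 3 ≤ t (v last)
        late-last = let w , white , w≢last , _ = other in
          ≤-trans (s≤s (late-other white w≢last)) (before-last w≢last)

        late : ∀ {w} → White w → 2 ≤ t (v w)
        late {w} white with w ≟ᶠ last
        ... | yes refl   = <⇒≤ late-last
        ... | no  w≢last = late-other white w≢last

        4≤T : 4 ≤ T
        4≤T = ≤-trans (s≤s late-last) (≤-trans (v<p-of-white white-last) (t≤T (p last)))

        module Tight (T≤4 : T ≤ 4) where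
          v≤2 : i ≢ last → t (v i) ≤ 2
          v≤2 i≢last = ≤-pred (≤-trans (before-last i≢last)
            (≤-pred (≤-trans (v<p-of-white white-last) (≤-trans (t≤T (p last)) T≤4))))

          target : ∀ {i} → Blue i → (v i ⇝ v₀ × t v₀ ≤ 2) ⊎ ∃[ j ] v i ⇝ v j × White j × t (v j) ≤ 2
          target {i} blueᵢ with target-of-blue blueᵢ (proj₂ (defect-v⇒ (sound v₀≢v)))
          ... | inj₁ i0 = contradiction v₀≡0 (>⇒≢ (proj₁ i0))
          ... | inj₂ (j , ij) = inj₂ (j , ij , white-target (sound v₀≢p) ij v≢p ,
            v≤2 (λ j≡last → v₀≢v (⇝-injective (proj₂ v₀-target) (subst (λ j → v i ⇝ v j) j≡last ij))))

          2∣1+B : 2 ∣ suc (total initially)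
          2∣1+B = subst (2 ∣_) (cong suc (sym B≡1+S)) (∣m∣n⇒∣m+n ∣-refl
            (subst (2 ∣_) (trans (cong (sum blue +_) (ind-no (0 <? t v₀) (λ 0<v₀ → >⇒≢ 0<v₀ v₀≡0))) (+-identityʳ _))
              (Parity.parity 2 late target)))

      -- With `k` and `last` set aside, a spoke with white pendant remains. The chain of hub, this
      -- spoke, `last` and the pendant of `last` ends at time 5 at the earliest, so four steps are
      -- impossible in this case.
      module BlueSpoke (0<v₀ : 0 < t v₀) {k : Fin m} (vk≡0 : t (v k) ≡ 0) where

        spoke-defect : initially (v k) ≡ 1
        spoke-defect = ind-yes (t (v k) ≟ 0) vk≡0

        sound : ∀ {x} → v k ≢ x → defect x ≡ 0
        sound vk≢x = single-defect Δ≤1 vk≢x (≤-trans (≤-reflexive (sym spoke-defect)) (m≤m+n _ _))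

        0<v : i ≢ k → 0 < t (v i)
        0<v i≢k = proj₁ (defect-v⇒ (sound (λ eq → i≢k (sym (v-injective eq)))))

        2S≤m : sum blue + sum blue ≤ m
        2S≤m = halve-predecessor S<B 2B≡1+m
          where
          S<B : suc (sum blue) ≤ total initially
          S<B = ≤-trans (+-monoˡ-≤ (sum blue)
                  (≤-trans (≤-reflexive (sym spoke-defect)) (term≤sum (initially ∘ v) k)))
                (≤-trans (m≤n+m _ (initially v₀)) (≤-reflexive (sym total-initially)))

        early-forcer : ∃[ i ] v i ⇝ v₀
        early-forcer = forcer-of-v₀ 0<v₀

        v₀-target : ∃[ j ] v₀ ⇝ v j
        v₀-target = target-of-v₀ (proj₂ (defect-v₀⇒ (sound {v₀} (v₀≢v ∘ sym))))

        last : Fin m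
        last = proj₁ v₀-target

        white-last : White last
        white-last = white-target (sound v≢p) (proj₂ v₀-target) v₀≢p

        2≤hub : 2 ≤ t v₀
        -- The forcer of `v₀` is not `k`: it has a blue pendant, which for `k` would have to force
        -- `v k`, although `v k` is initially blue.
        2≤hub = 2≤v₀ (proj₂ early-forcer) (0<v (λ i≡k →
          >⇒≢ (proj₁ (target-of-p (defect-p⇒ (sound v≢p) (subst Blue i≡k (v⇝v₀⇒Blue (proj₂ early-forcer)))))) vk≡0))

        5≤T : 5 ≤ T
        5≤T = let w , white , w≢last , w≢k = white-avoiding₂ 2S≤m last k in
          ≤-trans (s≤s (≤-trans
              (s≤s (≤-trans (s≤s 2≤hub) (v₀<v-of-white white (0<v w≢k))))
              (others-before-target-of-v₀ (proj₂ v₀-target) w≢last)))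
            (≤-trans (v<p-of-white white-last) (t≤T (p last)))

      -- The possible defect is not yet located, so `v₀` need not force. A spoke with white pendant
      -- comes at time 3 or later and its pendant at 4 or later; four steps leave no time for `v₀`
      -- to force, which makes its idleness the only defect.
      module BluePendants (0<v₀ : 0 < t v₀) (0<v : ∀ i → 0 < t (v i)) where

        B≡S : total initially ≡ sum blue
        B≡S = all-blue-pendants 0<v₀ 0<v

        late : ∀ {w} → White w → 3 ≤ t (v w)
        late = late-forces 0<v (2≤v₀ (proj₂ (forcer-of-v₀ 0<v₀)) (0<v _))

        other-than : ∀ j → ∃[ w ] White w × w ≢ j
        other-than = white-avoiding₁ (≤-reflexive (trans (sym (cong₂ _+_ B≡S B≡S)) 2B≡1+m))

        witness : ∃[ w ] White w
        witness = let w , white , _ = other-than (proj₁ (forcer-of-v₀ 0<v₀)) in w , white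

        4≤T : 4 ≤ T
        4≤T = let w , white = witness in
          ≤-trans (s≤s (late white)) (≤-trans (v<p-of-white white) (t≤T (p w)))

        module Tight (T≤4 : T ≤ 4) where
          v≤3 : White w → t (v w) ≤ 3
          v≤3 {w} white = ≤-pred (≤-trans (v<p-of-white white) (≤-trans (t≤T (p w)) T≤4))

          -- A spoke forced by v₀ is the last one, so its pendant would have to be blue and idle;
          -- the spoke itself then has nothing left to force in time.
          idle-hub : ¬ Source v₀
          idle-hub source = 1+n≰n (≤-trans (s≤s last≤3) (late-last))
            where
            v₀-target : ∃[ j ] v₀ ⇝ v j
            v₀-target = target-of-v₀ source

            last : Fin m
            last = proj₁ v₀-target

            late-last : 4 ≤ t (v last)
            late-last = let w , white , w≢last = other-than last in
              ≤-trans (s≤s (late white)) (others-before-target-of-v₀ (proj₂ v₀-target) w≢last)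

            last≤3 : t (v last) ≤ 3
            last≤3 with t (p last) ≟ 0
            ... | no ¬blue   = v≤3 (¬Blue⇒White ¬blue)
            ... | yes blueₗ = let x , lx = proj₂ (defect-v⇒ {last} (single-defect Δ≤1 {p last} (v≢p ∘ sym) 0<defect)) in
              ≤-pred (≤-trans (⇝⇒< lx) (≤-trans (t≤T x) T≤4))
              where
              0<defect : 0 < defect (p last)
              0<defect = n≢0⇒n>0 (λ d≡0 →
                v₀≢p (⇝-injective (proj₂ v₀-target) (target-of-p (defect-p⇒ d≡0 blueₗ))))

          sound : ∀ {x} → v₀ ≢ x → defect x ≡ 0
          sound v₀≢x = single-defect Δ≤1 v₀≢x (n≢0⇒n>0 (idle-hub ∘ proj₂ ∘ defect-v₀⇒))

          target : ∀ {i} → Blue i → (v i ⇝ v₀ × t v₀ ≤ 3) ⊎ ∃[ j ] v i ⇝ v j × White j × t (v j) ≤ 3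
          target {i} blueᵢ with target-of-blue blueᵢ (proj₂ (defect-v⇒ (sound v₀≢v)))
          ... | inj₁ i0 = inj₁ (i0 , (let w , white = witness in
            <⇒≤ (<-≤-trans (v₀<v-of-white white (0<v w)) (v≤3 white))))
          ... | inj₂ (j , ij) = let white = white-target (sound v₀≢p) ij v≢p in
            inj₂ (j , ij , white , v≤3 white)

          2∣1+B : 2 ∣ suc (total initially)
          2∣1+B = suc∣ 0<v₀ B≡S (Parity.parity 3 late target)

      odd-bounds : 4 ≤ T × (T ≤ 4 → 2 ∣ suc (total initially))
      odd-bounds = by-hub (t v₀ ≟ 0) (any? (λ k → t (v k) ≟ 0))
        where
        by-hub : Dec (t v₀ ≡ 0) → Dec (∃[ k ] t (v k) ≡ 0) → 4 ≤ T × (T ≤ 4 → 2 ∣ suc (total initially))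
        by-hub (yes v₀≡0) _ = BlueHub.4≤T v₀≡0 , BlueHub.Tight.2∣1+B v₀≡0
        by-hub (no v₀≢0) (yes (k , vk≡0)) = <⇒≤ 5≤T , λ T≤4 → contradiction T≤4 (<⇒≱ 5≤T)
          where open BlueSpoke (n≢0⇒n>0 v₀≢0) vk≡0 using (5≤T)
        by-hub (no v₀≢0) (no none) = 4≤T , Tight.2∣1+B
          where open BluePendants (n≢0⇒n>0 v₀≢0) (λ i → n≢0⇒n>0 (λ vi≡0 → none (i , vi≡0)))

-- Fast zero forcing sets

-- A spoke has a blue pendant iff it turns blue at time 1.
pendantTime : ℕ → ℕ → ℕ
pendantTime T 1 = 0
pendantTime T _ = T

pendantTime-cases : ∀ T a → pendantTime T a ≡ 0 ⊎ pendantTime T a ≡ T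
pendantTime-cases T 0             = inj₂ refl
pendantTime-cases T 1             = inj₁ refl
pendantTime-cases T (suc (suc _)) = inj₂ refl

-- All white pendants wait for the final time `T`. When the rest is blue before `T`, each spoke can
-- then force its own pendant, so only the spokes and the hub need scheduling.
helmTime : ∀ {m} → (ℕ → ℕ) → ℕ → ℕ → HelmVertex m → ℕ
helmTime a c T v₀    = c
helmTime a c T (v i) = a (toℕ i)
helmTime a c T (p i) = pendantTime T (a (toℕ i))

-- a n and c are the times of the spoke n and of the hub; in the last two constructors the
-- forcer is the spoke suc n, which has a blue pendant and does not touch the edge closing the rim.
data RimForced (a : ℕ → ℕ) (c m : ℕ) : ℕ → Set where
  by-pendant : ∀ {n} → a n ≡ 1 → RimForced a c m n
  leftward   : ∀ {n} → a (suc n) ≡ 1 → 2 + n < m →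
               1 < a n → c < a n → a (2 + n) < a n → RimForced a c m n
  rightward  : ∀ {n} → a (suc n) ≡ 1 →
               1 < a (2 + n) → c < a (2 + n) → a n < a (2 + n) → RimForced a c m (2 + n)

HubForces : (ℕ → ℕ) → ℕ → ℕ → Set
HubForces a c n = c < a n × (∀ k → k ≢ n → a k < a n)

HubForced : (ℕ → ℕ) → ℕ → ℕ → Set
HubForced a c m = c ≡ 0 ⊎ ∃[ n ] 2 + n < m × a n < c × a (suc n) ≡ 1 × 1 < c × a (2 + n) < c

module _ {m : ℕ} {a : ℕ → ℕ} {c T : ℕ} (a<T : ∀ n → a n < T) (c<T : c < T)
  (hub : HubForced a c m) (rimForced : ∀ n → n < m → RimForced a c m n ⊎ HubForces a c n) where

  private
    t : HelmVertex m → ℕ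
    t = helmTime a c T

    interior-neighbours : ∀ {i : Fin m} {n x} {P : HelmVertex m → Set} → toℕ i ≡ suc n → 2 + n < m →
      P v₀ → P (p i) → (∀ j → toℕ j ≡ n → P (v j)) → (∀ j → toℕ j ≡ 2 + n → P (v j)) → v i ~ x → P x
    interior-neighbours i≡ <m h q l r (bwd (spoke _))     = h
    interior-neighbours i≡ <m h q l r (fwd (pendant _))   = q
    interior-neighbours i≡ <m h q l r (fwd (rim j≡))      = r _ (trans j≡ (cong suc i≡))
    interior-neighbours i≡ <m h q l r (fwd (closing i≡0 _)) = contradiction (trans (sym i≡) i≡0) 1+n≢0
    interior-neighbours i≡ <m h q l r (bwd (rim i≡′))     = l _ (suc-injective (trans (sym i≡′) i≡))
    interior-neighbours i≡ <m h q l r (bwd (closing _ i≡m)) =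
      contradiction (trans (sym (cong suc i≡)) i≡m) (<⇒≢ <m)

    blue-pendant : ∀ {i : Fin m} {n} → toℕ i ≡ n → a n ≡ 1 → t (p i) ≡ 0
    blue-pendant i≡n an≡1 = cong (pendantTime T) (trans (cong a i≡n) an≡1)

    -- The conditions on the hub and on the two adjacent spokes exempt `x` itself, so that forcing
    -- the hub and forcing in either rim direction are covered at once.
    forced-by-spoke : ∀ {n x} → a (suc n) ≡ 1 → 2 + n < m →
      (∀ {i} → toℕ i ≡ suc n → v i ~ x) →
      1 < t x → (v₀ ≢ x → c < t x) →
      (∀ j → toℕ j ≡ n → v j ≢ x → a n < t x) → (∀ j → toℕ j ≡ 2 + n → v j ≢ x → a (2 + n) < t x) →
      ∃[ u ] ForcedBy _~_ t u x
    forced-by-spoke {n} {x} a≡1 <m adjacent 1<tx c<tx l<tx r<tx = v i , adjacent i≡ ,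
      subst (_< t x) (sym (trans (cong a i≡) a≡1)) 1<tx ,
      λ w → interior-neighbours {P = λ w → w ≢ x → t w < t x} i≡ <m c<tx
        (λ _ → subst (_< t x) (sym (blue-pendant i≡ a≡1)) (<⇒≤ 1<tx))
        (λ j j≡ j≢x → subst (λ k → a k < t x) (sym j≡) (l<tx j j≡ j≢x))
        (λ j j≡ j≢x → subst (λ k → a k < t x) (sym j≡) (r<tx j j≡ j≢x))
      where
      i : Fin m
      i = fromℕ< (<⇒≤ <m)

      i≡ : toℕ i ≡ suc n
      i≡ = toℕ-fromℕ< (<⇒≤ <m)

  helmTime-chronology : IsChronology _~_ t
  helmTime-chronology v₀ = by-cases hub
    where
    by-cases : HubForced a c m → c ≡ 0 ⊎ ∃[ u ] ForcedBy _~_ t u v₀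
    by-cases (inj₁ c≡0) = inj₁ c≡0
    by-cases (inj₂ (n , <m , l<c , a≡1 , 1<c , r<c)) = inj₂ (forced-by-spoke a≡1 <m (λ _ → ~-sym v₀~v)
      1<c (contradiction refl) (λ _ _ _ → l<c) (λ _ _ _ → r<c))
  helmTime-chronology (p i) with pendantTime-cases T (a (toℕ i))
  ... | inj₁ ≡0 = inj₁ ≡0
  ... | inj₂ ≡T = inj₂ (v i , v~p , before (a<T (toℕ i)) , λ
    { _ (bwd (spoke _))       _   → before c<T
    ; _ (fwd (pendant _))     p≢p → contradiction refl p≢p
    ; _ (fwd (rim _))         _   → before (a<T _)
    ; _ (fwd (closing _ _))   _   → before (a<T _)
    ; _ (bwd (rim _))         _   → before (a<T _)
    ; _ (bwd (closing _ _))   _   → before (a<T _) })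
    where
    before : ∀ {k} → k < T → k < pendantTime T (a (toℕ i))
    before = subst (_ <_) (sym ≡T)
  helmTime-chronology (v i) = inj₂ (by-cases (rimForced (toℕ i) (toℕ<n i)) refl)
    where
    by-cases : ∀ {n} → RimForced a c m n ⊎ HubForces a c n → toℕ i ≡ n → ∃[ u ] ForcedBy _~_ t u (v i)
    by-cases (inj₁ (by-pendant a≡1)) refl = p i , ~-sym v~p ,
      subst₂ _<_ (sym (blue-pendant {i} refl a≡1)) (sym a≡1) (s≤s z≤n) ,
      λ w pw w≢v → contradiction (p~ pw) w≢v
    by-cases (inj₁ (leftward a≡1 <m 1<a c<a r<a)) refl = forced-by-spoke a≡1 <m
      (λ j≡ → bwd (rim j≡)) 1<a (λ _ → c<a)
      (λ j j≡ j≢i → contradiction (cong v (toℕ-injective j≡)) j≢i) (λ _ _ _ → r<a)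
    by-cases (inj₁ (rightward {n} a≡1 1<a c<a l<a)) i≡ = forced-by-spoke a≡1 (subst (_< m) i≡ (toℕ<n i))
      (λ j≡ → fwd (rim (trans i≡ (cong suc (sym j≡))))) (in-time 1<a) (λ _ → in-time c<a)
      (λ _ _ _ → in-time l<a) (λ j j≡ j≢i → contradiction (cong v (toℕ-injective (trans j≡ (sym i≡)))) j≢i)
      where
      in-time : ∀ {k} → k < a (2 + n) → k < a (toℕ i)
      in-time = subst (λ n → _ < a n) (sym i≡)
    by-cases (inj₂ (c<a , others<a)) refl = v₀ , v₀~v , c<a ,
      λ { w (fwd (spoke j)) j≢i → others<a (toℕ j) (λ j≡ → j≢i (cong v (toℕ-injective j≡))) }

  helmTime≤ : ∀ x → t x ≤ T
  helmTime≤ v₀    = <⇒≤ c<T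
  helmTime≤ (v i) = <⇒≤ (a<T _)
  helmTime≤ (p i) = [ (λ ≡0 → subst (_≤ T) (sym ≡0) z≤n) , ≤-reflexive ]′ (pendantTime-cases T (a (toℕ i)))

-- The meeting point of both bounds: fast schedules are built in this form, and every completed
-- propagation on the `Fin`-indexed helm yields one.
record Colourable (m b T : ℕ) : Set where
  constructor colouring
  field
    time          : HelmVertex m → ℕ
    chronological : IsChronology _~_ time
    time≤         : ∀ x → time x ≤ T
    count         : ind (time v₀ ≟ 0) + (sum (λ i → ind (time (v i) ≟ 0)) + sum (λ i → ind (time (p i) ≟ 0))) ≡ b

helmTime-colourable : ∀ {m a c T s} → (∀ n → a n < T) → (∀ n → 0 < a n) → c < T → HubForced a c m →
  (∀ n → n < m → RimForced a c m n ⊎ HubForces a c n) →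
  sum {m} (λ i → ind (pendantTime T (a (toℕ i)) ≟ 0)) ≡ s → Colourable m (ind (c ≟ 0) + s) T
helmTime-colourable {m} {a} {c} {T} a<T 0<a c<T hub rimForced count =
  colouring (helmTime a c T) (helmTime-chronology a<T c<T hub rimForced) (helmTime≤ a<T c<T hub rimForced)
    (cong (ind (c ≟ 0) +_) (cong₂ _+_ (sum-zero {m} (λ i → ind-no (a (toℕ i) ≟ 0) (>⇒≢ (0<a (toℕ i))))) count))

_▷_ : List ℕ → (ℕ → ℕ) → ℕ → ℕ
([]       ▷ f) n       = f n
((x ∷ xs) ▷ f) zero    = x
((x ∷ xs) ▷ f) (suc n) = (xs ▷ f) n

block : ℕ → ℕ → ℕ
block x 0 = x
block x 1 = 1
block x 2 = 1
block x 3 = x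
block x (suc (suc (suc (suc n)))) = block x n

-- The sequence takes only the values 1, `x` and those of the prefix, so deciding `P` on this finite
-- list settles all `n`.
▷-block-all : ∀ {P : ℕ → Set} (P? : Decidable P) xs x {all : True (all? P? (1 ∷ x ∷ xs))} →
              ∀ n → P ((xs ▷ block x) n)
▷-block-all {P} P? xs x {all} = prefix-all (toWitness all)
  where
  block-all : P 1 → P x → ∀ n → P (block x n)
  block-all p1 px 0 = px
  block-all p1 px 1 = p1
  block-all p1 px 2 = p1
  block-all p1 px 3 = px
  block-all p1 px (suc (suc (suc (suc n)))) = block-all p1 px n

  prefix-all : ∀ {xs} → All P (1 ∷ x ∷ xs) → ∀ n → P ((xs ▷ block x) n)
  prefix-all (p1 ∷ px ∷ [])       n       = block-all p1 px n
  prefix-all (p1 ∷ px ∷ py ∷ pys) zero    = py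
  prefix-all (p1 ∷ px ∷ py ∷ pys) (suc n) = prefix-all (p1 ∷ px ∷ pys) n

▷-max : ∀ {y f} xs → (∀ n → (xs ▷ f) n < y) → ∀ k → k ≢ length xs → ((xs ++ y ∷ []) ▷ f) k < y
▷-max []       <y zero    0≢0 = contradiction refl 0≢0
▷-max []       <y (suc k) _   = <y k
▷-max (x ∷ xs) <y zero    _   = <y zero
▷-max (x ∷ xs) <y (suc k) k≢  = ▷-max xs (<y ∘ suc) k (k≢ ∘ cong suc)

-- This makes the spoke at the end of the prefix the last one on the whole rim, as is needed for
-- `v₀` to force it.
▷-block-max : ∀ xs y x {below : True (all? (_<? y) (1 ∷ x ∷ xs))} →
              ∀ k → k ≢ length xs → ((xs ++ y ∷ []) ▷ block x) k < y
▷-block-max xs y x {below} = ▷-max xs (▷-block-all (_<? y) xs x {below})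

rimForced-suc : ∀ {a c m n} → RimForced (a ∘ suc) c m n → RimForced a c (suc m) (suc n)
rimForced-suc (by-pendant a≡1)              = by-pendant a≡1
rimForced-suc (leftward a≡1 <m 1<a c<a r<a) = leftward a≡1 (s≤s <m) 1<a c<a r<a
rimForced-suc (rightward a≡1 1<a c<a l<a)   = rightward a≡1 1<a c<a l<a

rimForced-▷ : ∀ {f c m n} xs → RimForced f c m n → RimForced (xs ▷ f) c (length xs + m) (length xs + n)
rimForced-▷ []       forced = forced
rimForced-▷ (x ∷ xs) forced = rimForced-suc (rimForced-▷ xs forced)

rimForced-block : ∀ {x c} → 1 < x → c < x → ∀ q n → n < q * 4 → RimForced (block x) c (q * 4) n
rimForced-block 1<x c<x (suc q) 0 _ = leftward refl (s≤s (s≤s (s≤s z≤n))) 1<x c<x 1<x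
rimForced-block 1<x c<x (suc q) 1 _ = by-pendant refl
rimForced-block 1<x c<x (suc q) 2 _ = by-pendant refl
rimForced-block 1<x c<x (suc q) 3 _ = rightward refl 1<x c<x 1<x
rimForced-block 1<x c<x (suc q) (suc (suc (suc (suc n)))) (s≤s (s≤s (s≤s (s≤s n<)))) =
  rimForced-suc (rimForced-suc (rimForced-suc (rimForced-suc (rimForced-block 1<x c<x q n n<))))

block-count : ∀ x T q → sum {q * 4} (λ i → ind (pendantTime (suc T) (block (2 + x) (toℕ i)) ≟ 0)) ≡ q * 2
block-count x T zero    = refl
block-count x T (suc q) = cong (2 +_) (block-count x T q)

lt : ∀ {i j} {i<j : True (i <? j)} → i < j
lt {i<j = i<j} = toWitness i<j

-- A block x 1 1 x consists of two spokes with blue pendant that force the two outer ones.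
-- The last spoke of the prefix is forced by v₀; hub forcing needs three consecutive 1s in the
-- prefix unless v₀ is initially blue.

colourable-5 : ∀ q → Colourable (5 + q * 4) (3 + q * 2) 4
colourable-5 q = helmTime-colourable {a = xs ▷ block 2}
  (▷-block-all (_<? 4) xs 2) (▷-block-all (0 <?_) xs 2) lt (inj₁ refl) rimForced
  (cong (2 +_) (block-count 0 3 q))
  where
  xs : List ℕ
  xs = 2 ∷ 1 ∷ 1 ∷ 2 ∷ 3 ∷ []

  rimForced : ∀ n → n < 5 + q * 4 → RimForced (xs ▷ block 2) 0 (5 + q * 4) n ⊎ HubForces (xs ▷ block 2) 0 n
  rimForced 0 _ = inj₁ (leftward refl lt lt lt lt)
  rimForced 1 _ = inj₁ (by-pendant refl)
  rimForced 2 _ = inj₁ (by-pendant refl)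
  rimForced 3 _ = inj₁ (rightward refl lt lt lt)
  rimForced 4 _ = inj₂ (lt , ▷-block-max (2 ∷ 1 ∷ 1 ∷ 2 ∷ []) 3 2)
  rimForced (suc (suc (suc (suc (suc n))))) (s≤s (s≤s (s≤s (s≤s (s≤s n<))))) =
    inj₁ (rimForced-▷ xs (rimForced-block lt lt q n n<))

colourable-6 : ∀ q → Colourable (6 + q * 4) (3 + q * 2) 5
colourable-6 q = helmTime-colourable {a = xs ▷ block 3}
  (▷-block-all (_<? 5) xs 3) (▷-block-all (0 <?_) xs 3) lt (inj₂ (1 , lt , lt , refl , lt , lt)) rimForced
  (cong (3 +_) (block-count 1 4 q))
  where
  xs : List ℕ
  xs = 3 ∷ 1 ∷ 1 ∷ 1 ∷ 3 ∷ 4 ∷ []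

  rimForced : ∀ n → n < 6 + q * 4 → RimForced (xs ▷ block 3) 2 (6 + q * 4) n ⊎ HubForces (xs ▷ block 3) 2 n
  rimForced 0 _ = inj₁ (leftward refl lt lt lt lt)
  rimForced 1 _ = inj₁ (by-pendant refl)
  rimForced 2 _ = inj₁ (by-pendant refl)
  rimForced 3 _ = inj₁ (by-pendant refl)
  rimForced 4 _ = inj₁ (rightward refl lt lt lt)
  rimForced 5 _ = inj₂ (lt , ▷-block-max (3 ∷ 1 ∷ 1 ∷ 1 ∷ 3 ∷ []) 4 3)
  rimForced (suc (suc (suc (suc (suc (suc n)))))) (s≤s (s≤s (s≤s (s≤s (s≤s (s≤s n<)))))) =
    inj₁ (rimForced-▷ xs (rimForced-block lt lt q n n<))

colourable-7 : ∀ q → Colourable (7 + q * 4) (4 + q * 2) 5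
colourable-7 q = helmTime-colourable {a = xs ▷ block 3}
  (▷-block-all (_<? 5) xs 3) (▷-block-all (0 <?_) xs 3) lt (inj₂ (1 , lt , lt , refl , lt , lt)) rimForced
  (cong (4 +_) (block-count 1 4 q))
  where
  -- Of the four consecutive 1s the outer two force the spokes at time 3 and one inner one forces
  -- `v₀`. The other inner one forces nothing, which is the defect available for odd `m`.
  xs : List ℕ
  xs = 3 ∷ 1 ∷ 1 ∷ 1 ∷ 1 ∷ 3 ∷ 4 ∷ []

  rimForced : ∀ n → n < 7 + q * 4 → RimForced (xs ▷ block 3) 2 (7 + q * 4) n ⊎ HubForces (xs ▷ block 3) 2 n
  rimForced 0 _ = inj₁ (leftward refl lt lt lt lt)
  rimForced 1 _ = inj₁ (by-pendant refl)
  rimForced 2 _ = inj₁ (by-pendant refl)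
  rimForced 3 _ = inj₁ (by-pendant refl)
  rimForced 4 _ = inj₁ (by-pendant refl)
  rimForced 5 _ = inj₁ (rightward refl lt lt lt)
  rimForced 6 _ = inj₂ (lt , ▷-block-max (3 ∷ 1 ∷ 1 ∷ 1 ∷ 1 ∷ 3 ∷ []) 4 3)
  rimForced (suc (suc (suc (suc (suc (suc (suc n))))))) (s≤s (s≤s (s≤s (s≤s (s≤s (s≤s (s≤s n<))))))) =
    inj₁ (rimForced-▷ xs (rimForced-block lt lt q n n<))

colourable-8 : ∀ q → Colourable (8 + q * 4) (4 + q * 2) 6
colourable-8 q = helmTime-colourable {a = xs ▷ block 3}
  (▷-block-all (_<? 6) xs 3) (▷-block-all (0 <?_) xs 3) lt (inj₂ (1 , lt , lt , refl , lt , lt)) rimForced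
  (cong (4 +_) (block-count 1 5 q))
  where
  -- The run of three 1s forces `v₀` and the spokes on both sides. The isolated 1 can force only
  -- after its left neighbour has turned blue at time 3, which costs the additional step.
  xs : List ℕ
  xs = 3 ∷ 1 ∷ 1 ∷ 1 ∷ 3 ∷ 1 ∷ 4 ∷ 5 ∷ []

  rimForced : ∀ n → n < 8 + q * 4 → RimForced (xs ▷ block 3) 2 (8 + q * 4) n ⊎ HubForces (xs ▷ block 3) 2 n
  rimForced 0 _ = inj₁ (leftward refl lt lt lt lt)
  rimForced 1 _ = inj₁ (by-pendant refl)
  rimForced 2 _ = inj₁ (by-pendant refl)
  rimForced 3 _ = inj₁ (by-pendant refl)
  rimForced 4 _ = inj₁ (rightward refl lt lt lt)
  rimForced 5 _ = inj₁ (by-pendant refl)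
  rimForced 6 _ = inj₁ (rightward refl lt lt lt)
  rimForced 7 _ = inj₂ (lt , ▷-block-max (3 ∷ 1 ∷ 1 ∷ 1 ∷ 3 ∷ 1 ∷ 4 ∷ []) 5 3)
  rimForced (suc (suc (suc (suc (suc (suc (suc (suc n)))))))) (s≤s (s≤s (s≤s (s≤s (s≤s (s≤s (s≤s (s≤s n<)))))))) =
    inj₁ (rimForced-▷ xs (rimForced-block lt lt q n n<))

-- Propagation times of helm graphs

module _ {m : ℕ} (3≤m : 3 ≤ m) where

  private
    H : Graph
    H = helm m 3≤m

  open ZeroForcing H using (blueAfter)
  open Propagation H
  open Inverse (helmVertices m) using (to; from; strictlyInverseʳ)

  colourable⇒blueAfter : ∀ {b T} → Colourable m b T → ∃[ B ] ∣ B ∣ ≡ b × blueAfter B T ≡ ⊤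
  colourable⇒blueAfter (colouring t chronological t≤T count) = initial chronology ,
    trans (∣initial∣ chronology) (trans (sum-helm m (λ x → ind (t x ≟ 0))) count) ,
    chronology⇒blueAfter≡⊤ chronology (t≤T ∘ to)
    where
    chronology : IsChronology (Graph.Adj H) (t ∘ to)
    chronology = chronology-pullback (helmVertices m) chronological

  blueAfter⇒colourable : ∀ {B T} → blueAfter B T ≡ ⊤ → Colourable m ∣ B ∣ T
  blueAfter⇒colourable {B} eq = let t , chronological , t≤T , count = chronology⁺ B eq in
    colouring (t ∘ from) (chronology-pushforward (helmVertices m) chronological) (t≤T ∘ from)
      (sym (trans count (sum-helm′ t)))
    where
    sum-helm′ : ∀ t → sum (λ x → ind (t x ≟ 0)) ≡
      ind (t (from v₀) ≟ 0) + (sum (λ i → ind (t (from (v i)) ≟ 0)) + sum (λ i → ind (t (from (p i)) ≟ 0)))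
    sum-helm′ t = trans (sum-cong-≗ (λ x → cong (λ x → ind (t x ≟ 0)) (sym (strictlyInverseʳ x))))
      (sum-helm m (λ x → ind (t (from x) ≟ 0)))

  -- The first bound on all colourings makes `b` the zero forcing number. Every minimum zero forcing
  -- set then has `b` elements, and the second bound limits its propagation time from below.
  isPropagationTime : ∀ {b T} → Colourable m b T →
    (∀ {b′ T′} → Colourable m b′ T′ → b ≤ b′) → (∀ {T′} → Colourable m b T′ → T ≤ T′) →
    IsPropagationTime (helm m 3≤m) T
  isPropagationTime {b} {T} colourable fewest fastest =
    (B , zeroForcing , zeroForcingNumber , eq , λ j eqⱼ → fastest-set ∣B∣≡b eqⱼ) ,
    λ { j (B′ , zf′ , (_ , least) , (eq′ , _)) →
        fastest-set (≤-antisym (subst (∣ B′ ∣ ≤_) ∣B∣≡b (least ∣ B ∣ (B , zeroForcing , refl))) (fewest-set zf′)) eq′ }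
    where
    B : Subset (suc (m + m))
    B = proj₁ (colourable⇒blueAfter colourable)

    ∣B∣≡b : ∣ B ∣ ≡ b
    ∣B∣≡b = proj₁ (proj₂ (colourable⇒blueAfter colourable))

    eq : blueAfter B T ≡ ⊤
    eq = proj₂ (proj₂ (colourable⇒blueAfter colourable))

    zeroForcing : IsZeroForcingSet H B
    zeroForcing = blueAfter≡⊤⇒zeroForcingSet {k = T} eq

    fewest-set : ∀ {B′} → IsZeroForcingSet H B′ → b ≤ ∣ B′ ∣
    fewest-set {B′} zf = let k , eq′ = zeroForcingSet⇒blueAfter≡⊤ zf in
      fewest (blueAfter⇒colourable {B′} {k} eq′)

    fastest-set : ∀ {B′ j} → ∣ B′ ∣ ≡ b → blueAfter B′ j ≡ ⊤ → T ≤ j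
    fastest-set {B′} {j} ∣B′∣≡b eq′ =
      fastest (subst (λ b → Colourable m b j) ∣B′∣≡b (blueAfter⇒colourable {B′} {j} eq′))

    zeroForcingNumber : IsZeroForcingNumber H ∣ B ∣
    zeroForcingNumber = (B , zeroForcing , refl) , λ { _ (B′ , zf′ , refl) → subst (_≤ ∣ B′ ∣) (sym ∣B∣≡b) (fewest-set zf′) }

opaque
  colourable-bounds : ∀ {m b T} → 5 ≤ m → Colourable m b T →
    m ≤ b + b × (b + b ≡ m → 5 ≤ T × (T ≤ 5 → 2 ∣ suc b)) × (b + b ≡ suc m → 4 ≤ T × (T ≤ 4 → 2 ∣ suc b))
  colourable-bounds {m} {b} {T} 5≤m (colouring t chronological t≤T count) =
    subst (λ b → m ≤ b + b × (b + b ≡ m → 5 ≤ T × (T ≤ 5 → 2 ∣ suc b)) × (b + b ≡ suc m → 4 ≤ T × (T ≤ 4 → 2 ∣ suc b)))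
      (trans total-initially count)
      (≤-trans (m≤n+m m _) total-defect≤ , even-bounds , Odd.odd-bounds)
    where
    open HelmChronology 5≤m chronological
    open Bounds t≤T

-- A smaller `b′` would lower the double by at least 2, more than the slack of 1. The slack lets one
-- lemma serve both parities of `m`.
fewest : ∀ {m b b′} → b + b ≤ suc m → m ≤ b′ + b′ → b ≤ b′
fewest {m} {b} {b′} 2b≤1+m m≤2b′ = ≮⇒≥ (λ b′<b → 1+n≰n (begin
  2 + (b′ + b′)      ≡⟨ cong suc (+-suc b′ b′) ⟨
  suc b′ + suc b′    ≤⟨ +-mono-≤ b′<b b′<b ⟩
  b + b              ≤⟨ 2b≤1+m ⟩
  suc m              ≤⟨ s≤s m≤2b′ ⟩
  suc (b′ + b′)      ∎))
  where open ≤-Reasoning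

module _ {m : ℕ} (3≤m : 3 ≤ m) (5≤m : 5 ≤ m) {b : ℕ} where

  private
    fewest-blue : b + b ≤ suc m → ∀ {b′ T′} → Colourable m b′ T′ → b ≤ b′
    fewest-blue 2b≤ colourable = fewest 2b≤ (proj₁ (colourable-bounds 5≤m colourable))

  propagation-even : b + b ≡ m → Colourable m b 5 → IsPropagationTime (helm m 3≤m) 5
  propagation-even 2b≡m colourable = isPropagationTime 3≤m colourable
    (fewest-blue (≤-trans (≤-reflexive 2b≡m) (n≤1+n m)))
    (λ colourable′ → proj₁ (proj₁ (proj₂ (colourable-bounds 5≤m colourable′)) 2b≡m))

  -- Five steps would make `suc b` even, so the general bound of 5 rises to 6 when `b` is even.
  propagation-even′ : b + b ≡ m → ¬ (2 ∣ suc b) → Colourable m b 6 → IsPropagationTime (helm m 3≤m) 6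
  propagation-even′ 2b≡m 2∤1+b colourable = isPropagationTime 3≤m colourable
    (fewest-blue (≤-trans (≤-reflexive 2b≡m) (n≤1+n m)))
    (λ colourable′ → ≰⇒> (2∤1+b ∘ proj₂ (proj₁ (proj₂ (colourable-bounds 5≤m colourable′)) 2b≡m)))

  propagation-odd : b + b ≡ suc m → Colourable m b 4 → IsPropagationTime (helm m 3≤m) 4
  propagation-odd 2b≡1+m colourable = isPropagationTime 3≤m colourable
    (fewest-blue (≤-reflexive 2b≡1+m))
    (λ colourable′ → proj₁ (proj₂ (proj₂ (colourable-bounds 5≤m colourable′)) 2b≡1+m))

  propagation-odd′ : b + b ≡ suc m → ¬ (2 ∣ suc b) → Colourable m b 5 → IsPropagationTime (helm m 3≤m) 5
  propagation-odd′ 2b≡1+m 2∤1+b colourable = isPropagationTime 3≤m colourable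
    (fewest-blue (≤-reflexive 2b≡1+m))
    (λ colourable′ → ≰⇒> (2∤1+b ∘ proj₂ (proj₂ (proj₂ (colourable-bounds 5≤m colourable′)) 2b≡1+m)))

2∤5+q*2 : ∀ q → ¬ (2 ∣ 5 + q * 2)
2∤5+q*2 q 2∣ with () ← ∣1⇒≡1 (∣m+n∣m⇒∣n (subst (2 ∣_) (+-comm 1 (4 + q * 2)) 2∣) (n∣m*n (2 + q)))

theorem3p9 : (m : ℕ) (5≤m : 5 ≤ m) →
    let H = helm m (≤-trans (m≤n+m 3 2) 5≤m) in
    (m % 4 ≡ 0 → IsPropagationTime H 6)
    × (m % 4 ≡ 1 → IsPropagationTime H 4)
    × (m % 4 ≡ 2 → IsPropagationTime H 5)
    × (m % 4 ≡ 3 → IsPropagationTime H 5)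
theorem3p9 m 5≤m =
  (λ m%4≡0 → class₀ (m / 4) (quotient m%4≡0)) ,
  (λ m%4≡1 → class₁ (m / 4) (quotient m%4≡1)) ,
  (λ m%4≡2 → class₂ (m / 4) (quotient m%4≡2)) ,
  (λ m%4≡3 → class₃ (m / 4) (quotient m%4≡3))
  where
  quotient : ∀ {r} → m % 4 ≡ r → m ≡ r + m / 4 * 4
  quotient m%4≡r = trans (m≡m%n+[m/n]*n m 4) (cong (_+ m / 4 * 4) m%4≡r)

  double : ∀ r q → (r + q * 2) + (r + q * 2) ≡ (r + r) + q * 4
  double = solve-∀

  class₀ : ∀ q → m ≡ q * 4 → IsPropagationTime (helm m (≤-trans (m≤n+m 3 2) 5≤m)) 6
  class₀ 0             m≡ = contradiction (subst (5 ≤_) m≡ 5≤m) (<⇒≱ lt)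
  class₀ 1             m≡ = contradiction (subst (5 ≤_) m≡ 5≤m) (<⇒≱ lt)
  class₀ (suc (suc q)) m≡ = propagation-even′ (≤-trans (m≤n+m 3 2) 5≤m) 5≤m (trans (double 4 q) (sym m≡)) (2∤5+q*2 q)
    (subst (λ m → Colourable m (4 + q * 2) 6) (sym m≡) (colourable-8 q))

  class₁ : ∀ q → m ≡ 1 + q * 4 → IsPropagationTime (helm m (≤-trans (m≤n+m 3 2) 5≤m)) 4
  class₁ 0       m≡ = contradiction (subst (5 ≤_) m≡ 5≤m) (<⇒≱ lt)
  class₁ (suc q) m≡ = propagation-odd (≤-trans (m≤n+m 3 2) 5≤m) 5≤m (trans (double 3 q) (cong suc (sym m≡)))
    (subst (λ m → Colourable m (3 + q * 2) 4) (sym m≡) (colourable-5 q))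

  class₂ : ∀ q → m ≡ 2 + q * 4 → IsPropagationTime (helm m (≤-trans (m≤n+m 3 2) 5≤m)) 5
  class₂ 0       m≡ = contradiction (subst (5 ≤_) m≡ 5≤m) (<⇒≱ lt)
  class₂ (suc q) m≡ = propagation-even (≤-trans (m≤n+m 3 2) 5≤m) 5≤m (trans (double 3 q) (sym m≡))
    (subst (λ m → Colourable m (3 + q * 2) 5) (sym m≡) (colourable-6 q))

  class₃ : ∀ q → m ≡ 3 + q * 4 → IsPropagationTime (helm m (≤-trans (m≤n+m 3 2) 5≤m)) 5
  class₃ 0       m≡ = contradiction (subst (5 ≤_) m≡ 5≤m) (<⇒≱ lt)
  class₃ (suc q) m≡ = propagation-odd′ (≤-trans (m≤n+m 3 2) 5≤m) 5≤m (trans (double 4 q) (cong suc (sym m≡))) (2∤5+q*2 q)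
    (subst (λ m → Colourable m (4 + q * 2) 5) (sym m≡) (colourable-7 q))
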